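{- Let $p\ge 3$ be a prime and $m\ge 1$ an integer, and define integers $d_m(n)$ by $$\frac{1}{(1-x)^{m}}\prod_{i=0}^{\infty}\frac{1}{(1-x^{p^{i}})^{(p-1)m}}=\sum_{n=0}^{\infty}d_{m}(n)x^{n}.$$ Suppose that either $p\ge 5$, or $p=3$ and $\nu_3(m)\ge 1$. Then for every integer $n\ge 1$, $$d_m(pn)\equiv d_m(n)\pmod{p^{\nu_p(m)+3}}.$$
   Context: $\nu_p(a)$ denotes the $p$-adic valuation of the integer $a$. -}

module Defs where

open import Data.Nat using (ℕ; zero; suc; _+_; _*_; _∸_; _^_)
open import Data.Nat.Divisibility using (_∣_; _∣?_)
open import Data.List using (upTo; map)
open import Data.Nat.ListAction using (sum)
open import Data.Bool using (if_then_else_)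
open import Data.Integer as ℤ using (ℤ; +_)
import Data.Integer.Divisibility as ℤ∣
open import Relation.Nullary using (¬_)
open import Relation.Nullary.Decidable using (⌊_⌋)

Series : Set
Series = ℕ → ℕ

_⊛_ : Series → Series → Series
(f ⊛ g) n = sum (map (λ k → f k * g (n ∸ k)) (upTo (suc n)))

one : Series
one zero    = 1
one (suc _) = 0

_^ˢ_ : Series → ℕ → Series
f ^ˢ zero  = one
f ^ˢ suc e = f ⊛ (f ^ˢ e)

-- 1/(1 - x^a) = Σ_j x^{a j}  (coefficient 1 at multiples of a).
geom : ℕ → Series
geom a n = if ⌊ a ∣? n ⌋ then 1 else 0

prodTo : ℕ → ℕ → ℕ → Series
prodTo p m zero    = geom 1 ^ˢ ((p ∸ 1) * m)
prodTo p m (suc N) = (geom (p ^ suc N) ^ˢ ((p ∸ 1) * m)) ⊛ prodTo p m N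

-- d_m(n): coefficient of x^n in (1-x)^{-m} ∏_{i≥0} (1-x^{p^i})^{-(p-1)m}.
-- Factors with p^i > n are 1 + O(x^{n+1}), so truncating the product at
-- i = n (p^n > n for p ≥ 2) gives the exact coefficient.
d : ℕ → ℕ → ℕ → ℕ
d p m n = ((geom 1 ^ˢ m) ⊛ prodTo p m n) n

IsValuation : ℕ → ℕ → ℕ → Set
IsValuation p m k = (p ^ k ∣ m) × ¬ (p ^ suc k ∣ m)
  where open import Data.Product using (_×_)

_≡_[mod_] : ℕ → ℕ → ℕ → Set
a ≡ b [mod M ] = (+ M) ℤ∣.∣ ((+ a) ℤ.- (+ b))

{-# OPTIONS --safe #-}

-- Put e = (p - 1) m. The product R = ∏_{i≥0} (1 - x^{p^i})^{-e} satisfies R(x) = (1 - x)^{-e} R(x^p), so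
-- the generating function is (1 - x)^{-pm} R(x^p), while it is also (1 - x)^{-m} R(x). Extracting the
-- coefficients of index pn reduces the theorem to the congruence
-- C(pm + pn - 1, pn) ≡ C(m + n - 1, n) modulo p^{k+3}.
--
-- Removing the multiples of p from the factorials, the ratio of these two binomials is Q(pm) / Q(0) with
-- Q(X) = ∏_{t<n} W(X + pt) and W(X) = (X + 1) ⋯ (X + p - 1). Pairing X + j with X + p - j shows that W is
-- a polynomial in Z = X (X + p), and replacing X = pt by pm + pt changes Z by a multiple of p²m. For p ≥ 5
-- the linear coefficient of this polynomial is divisible by p, because doubling permutes the nonzero residues
-- and 4 ≢ 1 modulo p; hence W(pm + pt) ≡ W(pt) modulo p³m. For p = 3 one gets instead
-- Q(3m) ≡ Q(0) (1 - 9 m n²) modulo 27m, and the missing factor 3 comes from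
-- n C(m + n - 1, n) = m C(m + n - 1, n - 1) and 3 ∣ m.

module Submission where

open import Defs
open import Algebra.Bundles using (CommutativeMonoid)
open import Data.Integer as ℤ using (ℤ; 0ℤ; 1ℤ) renaming (+_ to pos)
open import Data.Integer.Divisibility.Signed as ℤ∣ using (divides)
import Data.Integer.Properties as ℤ
import Data.Integer.Tactic.RingSolver as ℤSolver
open import Data.List using (applyUpTo)
open import Data.List.Properties using (map-upTo)
open import Data.Nat
open import Data.Nat.Divisibility
open import Data.Nat.ListAction using (sum)
open import Data.Nat.Primality using (Prime; euclidsLemma; prime⇒nonZero; prime⇒irreducible)
open import Data.Nat.Properties
open import Data.Nat.Tactic.RingSolver using (solve-∀)
open import Data.Product using (_×_; _,_; proj₁; proj₂; ∃)
open import Data.Sum as Sum using (_⊎_; inj₁; inj₂; [_,_]′)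
open import Function using (_∘_; id)
open import Level using (0ℓ)
open import Relation.Binary.Bundles using (Setoid)
open import Relation.Binary.PropositionalEquality
  using (_≡_; refl; sym; trans; cong; cong₂; subst; subst₂; _≗_; module ≡-Reasoning)
import Relation.Binary.Reasoning.Setoid as ≈-Reasoning
open import Relation.Binary.Structures using (IsEquivalence)
open import Relation.Nullary using (¬_; yes; no; contradiction)

-- Power series and dilation

⊛-applyUpTo : ∀ f g n → (f ⊛ g) n ≡ sum (applyUpTo (λ k → f k * g (n ∸ k)) (suc n))
⊛-applyUpTo f g n = cong sum (map-upTo (λ k → f k * g (n ∸ k)) (suc n))

⊛-zero : ∀ f g → (f ⊛ g) 0 ≡ f 0 * g 0
⊛-zero f g = +-identityʳ _

⊛-suc : ∀ f g n → (f ⊛ g) (suc n) ≡ f 0 * g (suc n) + ((f ∘ suc) ⊛ g) n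
⊛-suc f g n = trans (⊛-applyUpTo f g (suc n))
  (cong (f 0 * g (suc n) +_) (sym (⊛-applyUpTo (f ∘ suc) g n)))

-- The coefficient of index n sees only coefficients of index at most n. This is what makes
-- truncation of the infinite product harmless.
⊛-cong-≤ : ∀ {f f′ g g′} n → (∀ {k} → k ≤ n → f k ≡ f′ k) → (∀ {k} → k ≤ n → g k ≡ g′ k) →
           (f ⊛ g) n ≡ (f′ ⊛ g′) n
⊛-cong-≤ {f} {f′} {g} {g′} zero f≗ g≗ = begin
  (f ⊛ g) 0    ≡⟨ ⊛-zero f g ⟩
  f 0 * g 0    ≡⟨ cong₂ _*_ (f≗ z≤n) (g≗ z≤n) ⟩
  f′ 0 * g′ 0  ≡⟨ ⊛-zero f′ g′ ⟨
  (f′ ⊛ g′) 0  ∎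
  where open ≡-Reasoning
⊛-cong-≤ {f} {f′} {g} {g′} (suc n) f≗ g≗ = begin
  (f ⊛ g) (suc n)                            ≡⟨ ⊛-suc f g n ⟩
  f 0 * g (suc n) + ((f ∘ suc) ⊛ g) n        ≡⟨ cong₂ _+_ (cong₂ _*_ (f≗ z≤n) (g≗ ≤-refl))
                                                 (⊛-cong-≤ n (λ k≤n → f≗ (s≤s k≤n)) (λ k≤n → g≗ (m≤n⇒m≤1+n k≤n))) ⟩
  f′ 0 * g′ (suc n) + ((f′ ∘ suc) ⊛ g′) n    ≡⟨ ⊛-suc f′ g′ n ⟨
  (f′ ⊛ g′) (suc n)                          ∎
  where open ≡-Reasoning

⊛-cong : ∀ {f f′ g g′} → f ≗ f′ → g ≗ g′ → f ⊛ g ≗ f′ ⊛ g′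
⊛-cong f≗ g≗ n = ⊛-cong-≤ n (λ {k} _ → f≗ k) (λ {k} _ → g≗ k)

-- The combination `a * f k + g k` is the form in which `⊛-suc` presents the tail of a convolution,
-- as the induction for associativity meets it.
⊛-distribʳ : ∀ a f g h n → ((λ k → a * f k + g k) ⊛ h) n ≡ a * (f ⊛ h) n + (g ⊛ h) n
⊛-distribʳ a f g h zero = begin
  ((λ k → a * f k + g k) ⊛ h) 0      ≡⟨ ⊛-zero (λ k → a * f k + g k) h ⟩
  (a * f 0 + g 0) * h 0              ≡⟨ lemma a (f 0) (g 0) (h 0) ⟩
  a * (f 0 * h 0) + g 0 * h 0        ≡⟨ cong₂ (λ x y → a * x + y) (⊛-zero f h) (⊛-zero g h) ⟨
  a * (f ⊛ h) 0 + (g ⊛ h) 0          ∎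
  where
  open ≡-Reasoning
  lemma : ∀ a b c d → (a * b + c) * d ≡ a * (b * d) + c * d
  lemma = solve-∀
⊛-distribʳ a f g h (suc n) = begin
  ((λ k → a * f k + g k) ⊛ h) (suc n)
    ≡⟨ ⊛-suc (λ k → a * f k + g k) h n ⟩
  (a * f 0 + g 0) * h (suc n) + ((λ k → a * f (suc k) + g (suc k)) ⊛ h) n
    ≡⟨ cong ((a * f 0 + g 0) * h (suc n) +_) (⊛-distribʳ a (f ∘ suc) (g ∘ suc) h n) ⟩
  (a * f 0 + g 0) * h (suc n) + (a * ((f ∘ suc) ⊛ h) n + ((g ∘ suc) ⊛ h) n)
    ≡⟨ lemma a (f 0) (g 0) (h (suc n)) _ _ ⟩
  a * (f 0 * h (suc n) + ((f ∘ suc) ⊛ h) n) + (g 0 * h (suc n) + ((g ∘ suc) ⊛ h) n)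
    ≡⟨ cong₂ (λ x y → a * x + y) (⊛-suc f h n) (⊛-suc g h n) ⟨
  a * (f ⊛ h) (suc n) + (g ⊛ h) (suc n) ∎
  where
  open ≡-Reasoning
  lemma : ∀ a b c d e k → (a * b + c) * d + (a * e + k) ≡ a * (b * d + e) + (c * d + k)
  lemma = solve-∀

⊛-assoc : ∀ f g h → (f ⊛ g) ⊛ h ≗ f ⊛ (g ⊛ h)
⊛-assoc f g h zero = begin
  ((f ⊛ g) ⊛ h) 0       ≡⟨ ⊛-zero (f ⊛ g) h ⟩
  (f ⊛ g) 0 * h 0       ≡⟨ cong (_* h 0) (⊛-zero f g) ⟩
  f 0 * g 0 * h 0       ≡⟨ *-assoc (f 0) (g 0) (h 0) ⟩
  f 0 * (g 0 * h 0)     ≡⟨ cong (f 0 *_) (⊛-zero g h) ⟨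
  f 0 * (g ⊛ h) 0       ≡⟨ ⊛-zero f (g ⊛ h) ⟨
  (f ⊛ (g ⊛ h)) 0       ∎
  where open ≡-Reasoning
⊛-assoc f g h (suc n) = begin
  ((f ⊛ g) ⊛ h) (suc n)
    ≡⟨ ⊛-suc (f ⊛ g) h n ⟩
  (f ⊛ g) 0 * h (suc n) + (((f ⊛ g) ∘ suc) ⊛ h) n
    ≡⟨ cong₂ _+_ (cong (_* h (suc n)) (⊛-zero f g)) (⊛-cong {g = h} (⊛-suc f g) (λ _ → refl) n) ⟩
  f 0 * g 0 * h (suc n) + ((λ k → f 0 * g (suc k) + ((f ∘ suc) ⊛ g) k) ⊛ h) n
    ≡⟨ cong (f 0 * g 0 * h (suc n) +_) (⊛-distribʳ (f 0) (g ∘ suc) ((f ∘ suc) ⊛ g) h n) ⟩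
  f 0 * g 0 * h (suc n) + (f 0 * ((g ∘ suc) ⊛ h) n + (((f ∘ suc) ⊛ g) ⊛ h) n)
    ≡⟨ cong (λ x → f 0 * g 0 * h (suc n) + (f 0 * ((g ∘ suc) ⊛ h) n + x)) (⊛-assoc (f ∘ suc) g h n) ⟩
  f 0 * g 0 * h (suc n) + (f 0 * ((g ∘ suc) ⊛ h) n + ((f ∘ suc) ⊛ (g ⊛ h)) n)
    ≡⟨ lemma (f 0) (g 0) (h (suc n)) _ _ ⟩
  f 0 * (g 0 * h (suc n) + ((g ∘ suc) ⊛ h) n) + ((f ∘ suc) ⊛ (g ⊛ h)) n
    ≡⟨ cong (λ x → f 0 * x + ((f ∘ suc) ⊛ (g ⊛ h)) n) (⊛-suc g h n) ⟨
  f 0 * (g ⊛ h) (suc n) + ((f ∘ suc) ⊛ (g ⊛ h)) n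
    ≡⟨ ⊛-suc f (g ⊛ h) n ⟨
  (f ⊛ (g ⊛ h)) (suc n) ∎
  where
  open ≡-Reasoning
  lemma : ∀ a b c d e → a * b * c + (a * d + e) ≡ a * (b * c + d) + e
  lemma = solve-∀

-- Peels the convolution from its other end, so that commutativity follows by induction from this
-- and `⊛-suc`.
⊛-sucʳ : ∀ f g n → (f ⊛ g) (suc n) ≡ f (suc n) * g 0 + (f ⊛ (g ∘ suc)) n
⊛-sucʳ f g zero = begin
  (f ⊛ g) 1                            ≡⟨ ⊛-suc f g 0 ⟩
  f 0 * g 1 + ((f ∘ suc) ⊛ g) 0        ≡⟨ cong (f 0 * g 1 +_) (⊛-zero (f ∘ suc) g) ⟩
  f 0 * g 1 + f 1 * g 0                ≡⟨ +-comm (f 0 * g 1) _ ⟩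
  f 1 * g 0 + f 0 * g 1                ≡⟨ cong (f 1 * g 0 +_) (⊛-zero f (g ∘ suc)) ⟨
  f 1 * g 0 + (f ⊛ (g ∘ suc)) 0        ∎
  where open ≡-Reasoning
⊛-sucʳ f g (suc n) = begin
  (f ⊛ g) (2 + n)
    ≡⟨ ⊛-suc f g (suc n) ⟩
  f 0 * g (2 + n) + ((f ∘ suc) ⊛ g) (suc n)
    ≡⟨ cong (f 0 * g (2 + n) +_) (⊛-sucʳ (f ∘ suc) g n) ⟩
  f 0 * g (2 + n) + (f (2 + n) * g 0 + ((f ∘ suc) ⊛ (g ∘ suc)) n)
    ≡⟨ lemma (f 0 * g (2 + n)) (f (2 + n) * g 0) _ ⟩
  f (2 + n) * g 0 + (f 0 * g (2 + n) + ((f ∘ suc) ⊛ (g ∘ suc)) n)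
    ≡⟨ cong (f (2 + n) * g 0 +_) (⊛-suc f (g ∘ suc) n) ⟨
  f (2 + n) * g 0 + (f ⊛ (g ∘ suc)) (suc n) ∎
  where
  open ≡-Reasoning
  lemma : ∀ a b c → a + (b + c) ≡ b + (a + c)
  lemma = solve-∀

⊛-comm : ∀ f g → f ⊛ g ≗ g ⊛ f
⊛-comm f g zero = begin
  (f ⊛ g) 0  ≡⟨ ⊛-zero f g ⟩
  f 0 * g 0  ≡⟨ *-comm (f 0) (g 0) ⟩
  g 0 * f 0  ≡⟨ ⊛-zero g f ⟨
  (g ⊛ f) 0  ∎
  where open ≡-Reasoning
⊛-comm f g (suc n) = begin
  (f ⊛ g) (suc n)                          ≡⟨ ⊛-suc f g n ⟩
  f 0 * g (suc n) + ((f ∘ suc) ⊛ g) n      ≡⟨ cong₂ _+_ (*-comm (f 0) _) (⊛-comm (f ∘ suc) g n) ⟩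
  g (suc n) * f 0 + (g ⊛ (f ∘ suc)) n      ≡⟨ ⊛-sucʳ g f n ⟨
  (g ⊛ f) (suc n)                          ∎
  where open ≡-Reasoning

-- The hypothesis says that x^a divides f.
⊛-drop : ∀ a f g n → (∀ {i} → i < a → f i ≡ 0) → (f ⊛ g) (a + n) ≡ ((f ∘ (a +_)) ⊛ g) n
⊛-drop zero f g n f≡0 = refl
⊛-drop (suc a) f g n f≡0 = begin
  (f ⊛ g) (suc a + n)                            ≡⟨ ⊛-suc f g (a + n) ⟩
  f 0 * g (suc a + n) + ((f ∘ suc) ⊛ g) (a + n)  ≡⟨ cong₂ _+_ (cong (_* g (suc a + n)) (f≡0 z<s))
                                                     (⊛-drop a (f ∘ suc) g n (λ i<a → f≡0 (s<s i<a))) ⟩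
  ((f ∘ (suc a +_)) ⊛ g) n                       ∎
  where open ≡-Reasoning

⊛-zeroˡ : ∀ f g n → (∀ {i} → i ≤ n → f i ≡ 0) → (f ⊛ g) n ≡ 0
⊛-zeroˡ f g n f≡0 = trans (⊛-cong-≤ {f} {λ _ → 0} {g} {g} n f≡0 (λ _ → refl)) (zeroes n)
  where
  zeroes : ∀ n → ((λ _ → 0) ⊛ g) n ≡ 0
  zeroes zero    = refl
  zeroes (suc n) = trans (⊛-suc (λ _ → 0) g n) (zeroes n)

⊛-identityˡ : ∀ f → one ⊛ f ≗ f
⊛-identityˡ f zero    = trans (⊛-zero one f) (*-identityˡ (f 0))
⊛-identityˡ f (suc n) = begin
  (one ⊛ f) (suc n)                            ≡⟨ ⊛-suc one f n ⟩
  1 * f (suc n) + ((one ∘ suc) ⊛ f) n          ≡⟨ cong (1 * f (suc n) +_) (⊛-zeroˡ (one ∘ suc) f n (λ _ → refl)) ⟩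
  1 * f (suc n) + 0                            ≡⟨ trans (+-identityʳ _) (*-identityˡ _) ⟩
  f (suc n)                                    ∎
  where open ≡-Reasoning

^ˢ-distribˡ-+-⊛ : ∀ f a b → f ^ˢ (a + b) ≗ (f ^ˢ a) ⊛ (f ^ˢ b)
^ˢ-distribˡ-+-⊛ f zero b n = sym (⊛-identityˡ (f ^ˢ b) n)
^ˢ-distribˡ-+-⊛ f (suc a) b n = begin
  (f ⊛ (f ^ˢ (a + b))) n               ≡⟨ ⊛-cong {f = f} (λ _ → refl) (^ˢ-distribˡ-+-⊛ f a b) n ⟩
  (f ⊛ ((f ^ˢ a) ⊛ (f ^ˢ b))) n        ≡⟨ ⊛-assoc f (f ^ˢ a) (f ^ˢ b) n ⟨
  ((f ^ˢ suc a) ⊛ (f ^ˢ b)) n          ∎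
  where open ≡-Reasoning

-- h(x) = g(x^p)
record IsDilation (p : ℕ) (h g : Series) : Set where
  field
    on-multiples  : ∀ n → h (p * n) ≡ g n
    off-multiples : ∀ {n} → ¬ p ∣ n → h n ≡ 0
open IsDilation

IsDilation-respˡ : ∀ {p h h′ g} → h ≗ h′ → IsDilation p h g → IsDilation p h′ g
IsDilation-respˡ h≗ D .on-multiples n      = trans (sym (h≗ _)) (D .on-multiples n)
IsDilation-respˡ h≗ D .off-multiples {n} ∤ = trans (sym (h≗ n)) (D .off-multiples ∤)

dilation-tail : ∀ {p h g} → IsDilation p h g → IsDilation p (h ∘ (p +_)) (g ∘ suc)
dilation-tail {p} {h} D .on-multiples n = trans (cong h (sym (*-suc p n))) (D .on-multiples (suc n))
dilation-tail D .off-multiples ∤ = D .off-multiples (λ p∣p+n → ∤ (∣m+n∣m⇒∣n p∣p+n ∣-refl))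

-- In the first block of p coefficients of h only the one of index 0 survives; dropping the block
-- turns h and g into their tails, again a dilation.
dilation-⊛-on-multiples : ∀ {p h g} .{{_ : NonZero p}} → IsDilation p h g → ∀ f n →
                          (h ⊛ f) (p * n) ≡ (g ⊛ (f ∘ (p *_))) n
dilation-⊛-on-multiples {p} {h} {g} D f zero = begin
  (h ⊛ f) (p * 0)        ≡⟨ cong (h ⊛ f) (*-zeroʳ p) ⟩
  (h ⊛ f) 0              ≡⟨ ⊛-zero h f ⟩
  h 0 * f 0              ≡⟨ cong₂ _*_ (trans (cong h (sym (*-zeroʳ p))) (D .on-multiples 0)) (cong f (sym (*-zeroʳ p))) ⟩
  g 0 * f (p * 0)        ≡⟨ ⊛-zero g (f ∘ (p *_)) ⟨
  (g ⊛ (f ∘ (p *_))) 0   ∎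
  where open ≡-Reasoning
dilation-⊛-on-multiples {p@(suc q)} {h} {g} D f (suc n) = begin
  (h ⊛ f) (p * suc n)
    ≡⟨ cong (h ⊛ f) (*-suc p n) ⟩
  (h ⊛ f) (p + p * n)
    ≡⟨ ⊛-suc h f (q + p * n) ⟩
  h 0 * f (p + p * n) + ((h ∘ suc) ⊛ f) (q + p * n)
    ≡⟨ cong (h 0 * f (p + p * n) +_) (⊛-drop q (h ∘ suc) f (p * n) (λ i<q → D .off-multiples (>⇒∤ (s<s i<q)))) ⟩
  h 0 * f (p + p * n) + ((h ∘ (p +_)) ⊛ f) (p * n)
    ≡⟨ cong₂ _+_ (cong₂ _*_ (trans (cong h (sym (*-zeroʳ p))) (D .on-multiples 0)) (cong f (sym (*-suc p n))))
         (dilation-⊛-on-multiples (dilation-tail D) f n) ⟩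
  g 0 * f (p * suc n) + ((g ∘ suc) ⊛ (f ∘ (p *_))) n
    ≡⟨ ⊛-suc g (f ∘ (p *_)) n ⟨
  (g ⊛ (f ∘ (p *_))) (suc n) ∎
  where open ≡-Reasoning

sum-zeroes : ∀ f n → (∀ {i} → i < n → f i ≡ 0) → sum (applyUpTo f n) ≡ 0
sum-zeroes f zero    f≡0 = refl
sum-zeroes f (suc n) f≡0 = cong₂ _+_ (f≡0 z<s) (sum-zeroes (f ∘ suc) n (λ i<n → f≡0 (s<s i<n)))

dilation-⊛ : ∀ {p h g h′ g′} .{{_ : NonZero p}} → IsDilation p h g → IsDilation p h′ g′ →
             IsDilation p (h ⊛ h′) (g ⊛ g′)
dilation-⊛ {g = g} {h′ = h′} D D′ .on-multiples n =
  trans (dilation-⊛-on-multiples D h′ n) (⊛-cong {f = g} (λ _ → refl) (D′ .on-multiples) n)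
dilation-⊛ {p} {h} {g} {h′} D D′ .off-multiples {n} ∤n =
  trans (⊛-applyUpTo h h′ n) (sum-zeroes _ (suc n) (λ {k} k<1+n → term k (s≤s⁻¹ k<1+n)))
  where
  -- If p divided both k and n - k, it would divide n; so at least one factor of each term vanishes.
  term : ∀ k → k ≤ n → h k * h′ (n ∸ k) ≡ 0
  term k k≤n with p ∣? k
  ... | no  ∤k = cong (_* h′ (n ∸ k)) (D .off-multiples ∤k)
  ... | yes ∣k = trans (cong (h k *_) (D′ .off-multiples
                   (λ ∣n∸k → ∤n (subst (p ∣_) (m+[n∸m]≡n k≤n) (∣m∣n⇒∣m+n ∣k ∣n∸k))))) (*-zeroʳ (h k))

dilation-one : ∀ {p} .{{_ : NonZero p}} → IsDilation p one one
dilation-one {p}     .on-multiples zero     = cong one (*-zeroʳ p)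
dilation-one {suc q} .on-multiples (suc n)  = refl
dilation-one {p} .off-multiples {zero}  ∤0 = contradiction (p ∣0) ∤0
dilation-one .off-multiples {suc n} _  = refl

dilation-^ˢ : ∀ {p h g} .{{_ : NonZero p}} → IsDilation p h g → ∀ e → IsDilation p (h ^ˢ e) (g ^ˢ e)
dilation-^ˢ D zero    = dilation-one
dilation-^ˢ D (suc e) = dilation-⊛ D (dilation-^ˢ D e)

-- The truncated product and its functional equation

geom-∣ : ∀ {a n} → a ∣ n → geom a n ≡ 1
geom-∣ {a} {n} a∣n with a ∣? n
... | yes _  = refl
... | no a∤n = contradiction a∣n a∤n

geom-∤ : ∀ {a n} → ¬ a ∣ n → geom a n ≡ 0
geom-∤ {a} {n} a∤n with a ∣? n
... | yes a∣n = contradiction a∣n a∤n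
... | no _    = refl

dilation-geom : ∀ p a .{{_ : NonZero p}} → IsDilation p (geom (p * a)) (geom a)
dilation-geom p a .on-multiples n with a ∣? n
... | yes a∣n = geom-∣ (*-monoʳ-∣ p a∣n)
... | no  a∤n = geom-∤ (λ pa∣pn → a∤n (*-cancelˡ-∣ p pa∣pn))
dilation-geom p a .off-multiples ∤ = geom-∤ (λ pa∣n → ∤ (m*n∣⇒m∣ p a pa∣n))

-- ∏_{i=1}^{N+1} (1 - x^{p^i})^{-(p-1)m}
higherFactors : ℕ → ℕ → ℕ → Series
higherFactors p m zero    = geom (p ^ 1) ^ˢ ((p ∸ 1) * m)
higherFactors p m (suc N) = (geom (p ^ suc (suc N)) ^ˢ ((p ∸ 1) * m)) ⊛ higherFactors p m N

-- Replacing x by x^p turns the factor of index i into that of index i + 1.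
higherFactors-dilation : ∀ p m N .{{_ : NonZero p}} → IsDilation p (higherFactors p m N) (prodTo p m N)
higherFactors-dilation p m zero    = dilation-^ˢ (dilation-geom p 1) ((p ∸ 1) * m)
higherFactors-dilation p m (suc N) =
  dilation-⊛ (dilation-^ˢ (dilation-geom p (p ^ suc N)) ((p ∸ 1) * m)) (higherFactors-dilation p m N)

prodTo-suc : ∀ p m N → prodTo p m (suc N) ≗ (geom 1 ^ˢ ((p ∸ 1) * m)) ⊛ higherFactors p m N
prodTo-suc p m zero = ⊛-comm (geom (p ^ 1) ^ˢ ((p ∸ 1) * m)) (prodTo p m 0)
prodTo-suc p m (suc N) n = begin
  (A ⊛ prodTo p m (suc N)) n   ≡⟨ ⊛-cong {f = A} (λ _ → refl) (prodTo-suc p m N) n ⟩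
  (A ⊛ (B ⊛ C)) n              ≡⟨ ⊛-assoc A B C n ⟨
  ((A ⊛ B) ⊛ C) n              ≡⟨ ⊛-cong {g = C} (⊛-comm A B) (λ _ → refl) n ⟩
  ((B ⊛ A) ⊛ C) n              ≡⟨ ⊛-assoc B A C n ⟩
  (B ⊛ (A ⊛ C)) n              ∎
  where
  open ≡-Reasoning
  A = geom (p ^ suc (suc N)) ^ˢ ((p ∸ 1) * m)
  B = geom 1 ^ˢ ((p ∸ 1) * m)
  C = higherFactors p m N

^ˢ-one-≤ : ∀ f N → (∀ {k} → k ≤ N → f k ≡ one k) → ∀ e {k} → k ≤ N → (f ^ˢ e) k ≡ one k
^ˢ-one-≤ f N f≡1 zero    k≤N = refl
^ˢ-one-≤ f N f≡1 (suc e) {k} k≤N = trans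
  (⊛-cong-≤ {f} {one} {f ^ˢ e} {one} k (λ j≤k → f≡1 (≤-trans j≤k k≤N)) (λ j≤k → ^ˢ-one-≤ f N f≡1 e (≤-trans j≤k k≤N)))
  (⊛-identityˡ one k)

geom-one-≤ : ∀ {a k} → k < a → geom a k ≡ one k
geom-one-≤ {a} {zero}  _   = geom-∣ (a ∣0)
geom-one-≤ {a} {suc k} k<a = geom-∤ (>⇒∤ k<a)

n<p^n : ∀ p n → 2 ≤ p → n < p ^ n
n<p^n p zero    2≤p = z<s
n<p^n p (suc n) 2≤p = begin-strict
  suc n          <⟨ s<s (n<p^n p n 2≤p) ⟩
  1 + p ^ n      ≤⟨ +-monoˡ-≤ (p ^ n) (≤-trans z<s (n<p^n p n 2≤p)) ⟩
  p ^ n + p ^ n  ≡⟨ cong (p ^ n +_) (+-identityʳ (p ^ n)) ⟨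
  2 * p ^ n      ≤⟨ *-monoˡ-≤ (p ^ n) 2≤p ⟩
  p * p ^ n      ∎
  where open ≤-Reasoning

-- Each further factor is 1 up to the index j, since p^(M+1) > M + 1 > j.
prodTo-stable : ∀ p m → 2 ≤ p → ∀ N M {j} → j ≤ N → N ≤′ M → prodTo p m M j ≡ prodTo p m N j
prodTo-stable p m 2≤p N .N j≤N ≤′-refl = refl
prodTo-stable p m 2≤p N (suc M) {j} j≤N (≤′-step N≤M) = begin
  (A ⊛ prodTo p m M) j     ≡⟨ ⊛-cong-≤ {A} {one} {prodTo p m M} j A≡1 (λ _ → refl) ⟩
  (one ⊛ prodTo p m M) j   ≡⟨ ⊛-identityˡ (prodTo p m M) j ⟩
  prodTo p m M j           ≡⟨ prodTo-stable p m 2≤p N M j≤N N≤M ⟩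
  prodTo p m N j           ∎
  where
  open ≡-Reasoning
  A = geom (p ^ suc M) ^ˢ ((p ∸ 1) * m)
  A≡1 : ∀ {k} → k ≤ j → A k ≡ one k
  A≡1 k≤j = ^ˢ-one-≤ (geom (p ^ suc M)) j
    (λ i≤j → geom-one-≤ (≤-<-trans (≤-trans i≤j (≤-trans j≤N (≤-trans (≤′⇒≤ N≤M) (n≤1+n M)))) (n<p^n p (suc M) 2≤p)))
    ((p ∸ 1) * m) k≤j

d-multiple : ∀ p m n → 2 ≤ p → 1 ≤ n →
             d p m (p * n) ≡ (prodTo p m n ⊛ ((geom 1 ^ˢ (p * m)) ∘ (p *_))) n
d-multiple p@(suc q) m n@(suc n′) 2≤p 1≤n = begin
  ((geom 1 ^ˢ m) ⊛ prodTo p m (suc N)) (p * n)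
    ≡⟨ ⊛-cong {f = geom 1 ^ˢ m} (λ _ → refl) (prodTo-suc p m N) (p * n) ⟩
  ((geom 1 ^ˢ m) ⊛ ((geom 1 ^ˢ (q * m)) ⊛ H)) (p * n)
    ≡⟨ ⊛-assoc (geom 1 ^ˢ m) (geom 1 ^ˢ (q * m)) H (p * n) ⟨
  (((geom 1 ^ˢ m) ⊛ (geom 1 ^ˢ (q * m))) ⊛ H) (p * n)
    ≡⟨ ⊛-cong {g = H} (^ˢ-distribˡ-+-⊛ (geom 1) m (q * m)) (λ _ → refl) (p * n) ⟨
  ((geom 1 ^ˢ (p * m)) ⊛ H) (p * n)
    ≡⟨ ⊛-comm (geom 1 ^ˢ (p * m)) H (p * n) ⟩
  (H ⊛ (geom 1 ^ˢ (p * m))) (p * n)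
    ≡⟨ dilation-⊛-on-multiples (higherFactors-dilation p m N) (geom 1 ^ˢ (p * m)) n ⟩
  (prodTo p m N ⊛ ((geom 1 ^ˢ (p * m)) ∘ (p *_))) n
    ≡⟨ ⊛-cong-≤ {g = (geom 1 ^ˢ (p * m)) ∘ (p *_)} n (λ j≤n → prodTo-stable p m 2≤p n N j≤n (≤⇒≤′ n≤N)) (λ _ → refl) ⟩
  (prodTo p m n ⊛ ((geom 1 ^ˢ (p * m)) ∘ (p *_))) n ∎
  where
  open ≡-Reasoning
  -- `p * n` computes to `suc N`, so the product truncated there has the form that `prodTo-suc`
  -- splits.
  N = n′ + q * n
  H = higherFactors p m N
  n≤N : n ≤ N
  n≤N = ≤-trans (≤-trans (≤-reflexive (sym (*-identityˡ n))) (*-monoˡ-≤ n (s≤s⁻¹ 2≤p))) (m≤n+m (q * n) n′)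

-- Finite products and congruences

-- Kept general because the same rearrangements serve natural numbers, integers and dual numbers
-- modulo p.
module Product {c ℓ} (M : CommutativeMonoid c ℓ) where
  open CommutativeMonoid M renaming (refl to ≈-refl; sym to ≈-sym; trans to ≈-trans)
  open import Algebra.Properties.CommutativeSemigroup commutativeSemigroup using (interchange)
  open ≈-Reasoning setoid

  ∏ : (ℕ → Carrier) → ℕ → Carrier
  ∏ f zero    = ε
  ∏ f (suc n) = ∏ f n ∙ f n

  ∏-cong-< : ∀ {f g} n → (∀ {i} → i < n → f i ≈ g i) → ∏ f n ≈ ∏ g n
  ∏-cong-< zero    f≈g = ≈-refl
  ∏-cong-< (suc n) f≈g = ∙-cong (∏-cong-< n (λ i<n → f≈g (m<n⇒m<1+n i<n))) (f≈g ≤-refl)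

  ∏-cong : ∀ {f g} n → (∀ i → f i ≈ g i) → ∏ f n ≈ ∏ g n
  ∏-cong n f≈g = ∏-cong-< n (λ {i} _ → f≈g i)

  ∏-∙ : ∀ f g n → ∏ (λ i → f i ∙ g i) n ≈ ∏ f n ∙ ∏ g n
  ∏-∙ f g zero    = ≈-sym (identityˡ ε)
  ∏-∙ f g (suc n) = begin
    ∏ (λ i → f i ∙ g i) n ∙ (f n ∙ g n)  ≈⟨ ∙-congʳ (∏-∙ f g n) ⟩
    (∏ f n ∙ ∏ g n) ∙ (f n ∙ g n)        ≈⟨ interchange _ _ _ _ ⟩
    (∏ f n ∙ f n) ∙ (∏ g n ∙ g n)        ∎

  ∏-+ : ∀ f m n → ∏ f (m + n) ≈ ∏ f m ∙ ∏ (f ∘ (m +_)) n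
  ∏-+ f m zero    = begin
    ∏ f (m + 0)  ≡⟨ cong (∏ f) (+-identityʳ m) ⟩
    ∏ f m        ≈⟨ identityʳ _ ⟨
    ∏ f m ∙ ε    ∎
  ∏-+ f m (suc n) = begin
    ∏ f (m + suc n)                              ≡⟨ cong (∏ f) (+-suc m n) ⟩
    ∏ f (m + n) ∙ f (m + n)                      ≈⟨ ∙-congʳ (∏-+ f m n) ⟩
    (∏ f m ∙ ∏ (f ∘ (m +_)) n) ∙ f (m + n)       ≈⟨ assoc _ _ _ ⟩
    ∏ f m ∙ (∏ (f ∘ (m +_)) n ∙ f (m + n))       ∎

  ∏-reverse : ∀ f n → ∏ f n ≈ ∏ (λ i → f (n ∸ suc i)) n
  ∏-reverse f zero    = ≈-refl
  ∏-reverse f (suc n) = begin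
    ∏ f n ∙ f n                                  ≈⟨ comm _ _ ⟩
    f n ∙ ∏ f n                                  ≈⟨ ∙-cong (≈-sym (identityˡ (f n))) (∏-reverse f n) ⟩
    (ε ∙ f n) ∙ ∏ (λ i → f (n ∸ suc i)) n        ≈⟨ ∏-+ (λ i → f (n ∸ i)) 1 n ⟨
    ∏ (λ i → f (n ∸ i)) (suc n)                  ∎

  -- Pairs i with its mirror image 2h - 1 - i. For p = 2h + 1 and the residue j = i + 1 this is the
  -- pairing of j with p - j.
  ∏-fold : ∀ f h → ∏ f (h + h) ≈ ∏ (λ i → f i ∙ f (h + (h ∸ suc i))) h
  ∏-fold f h = begin
    ∏ f (h + h)                                    ≈⟨ ∏-+ f h h ⟩
    ∏ f h ∙ ∏ (f ∘ (h +_)) h                       ≈⟨ ∙-congˡ (∏-reverse (f ∘ (h +_)) h) ⟩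
    ∏ f h ∙ ∏ (λ i → f (h + (h ∸ suc i))) h        ≈⟨ ∏-∙ f _ h ⟨
    ∏ (λ i → f i ∙ f (h + (h ∸ suc i))) h          ∎

  ∏-even-odd : ∀ f h → ∏ f (h + h) ≈ ∏ (λ i → f (i + i)) h ∙ ∏ (λ i → f (suc (i + i))) h
  ∏-even-odd f zero    = ≈-sym (identityˡ ε)
  ∏-even-odd f (suc h) = begin
    ∏ f (suc h + suc h)                             ≡⟨ cong (∏ f ∘ suc) (+-suc h h) ⟩
    (∏ f (h + h) ∙ f (h + h)) ∙ f (suc (h + h))     ≈⟨ assoc _ _ _ ⟩
    ∏ f (h + h) ∙ (f (h + h) ∙ f (suc (h + h)))     ≈⟨ ∙-congʳ (∏-even-odd f h) ⟩
    (∏ (λ i → f (i + i)) h ∙ ∏ (λ i → f (suc (i + i))) h) ∙ (f (h + h) ∙ f (suc (h + h)))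
                                                    ≈⟨ interchange _ _ _ _ ⟩
    ∏ (λ i → f (i + i)) (suc h) ∙ ∏ (λ i → f (suc (i + i))) (suc h) ∎

  -- Doubling permutes the nonzero residues modulo 2h + 1 (here i stands for the residue i + 1).
  ∏-doubling : ∀ f h → (∀ i → f (suc (h + h) + i) ≈ f i) → ∏ (λ i → f (suc (i + i))) (h + h) ≈ ∏ f (h + h)
  ∏-doubling f h periodic = begin
    ∏ (λ i → f (suc (i + i))) (h + h)
      ≈⟨ ∏-+ (λ i → f (suc (i + i))) h h ⟩
    ∏ (λ i → f (suc (i + i))) h ∙ ∏ (λ i → f (suc ((h + i) + (h + i)))) h
      ≈⟨ ∙-congˡ (∏-cong h wrap) ⟩
    ∏ (λ i → f (suc (i + i))) h ∙ ∏ (λ i → f (i + i)) h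
      ≈⟨ comm _ _ ⟩
    ∏ (λ i → f (i + i)) h ∙ ∏ (λ i → f (suc (i + i))) h
      ≈⟨ ∏-even-odd f h ⟨
    ∏ f (h + h) ∎
    where
    open import Algebra.Properties.CommutativeSemigroup +-commutativeSemigroup
      using () renaming (interchange to +-interchange)
    -- In the upper half, 2 (h + i) + 1 = (2h + 1) + 2i, so by periodicity these odd indices supply
    -- the even ones.
    wrap : ∀ i → f (suc ((h + i) + (h + i))) ≈ f (i + i)
    wrap i = ≈-trans (reflexive (cong (f ∘ suc) (+-interchange h i h i))) (periodic (i + i))

infix 4 _≋_[_]

-- A record, so that `a` and `b` can be inferred from a congruence; the difference alone does not
-- determine them.
record _≋_[_] (a b M : ℤ) : Set where
  constructor mod
  field difference : M ℤ∣.∣ a ℤ.- b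
open _≋_[_] public

module _ {M : ℤ} where

  ≋-reflexive : ∀ {a b} → a ≡ b → a ≋ b [ M ]
  ≋-reflexive {a} refl = mod (divides 0ℤ (ℤ.+-inverseʳ a))

  ≋-sym : ∀ {a b} → a ≋ b [ M ] → b ≋ a [ M ]
  ≋-sym {a} {b} (mod e) = mod (subst (M ℤ∣.∣_) (lemma a b) (ℤ∣.∣m⇒∣-m e))
    where
    lemma : ∀ a b → ℤ.- (a ℤ.- b) ≡ b ℤ.- a
    lemma = ℤSolver.solve-∀

  ≋-trans : ∀ {a b c} → a ≋ b [ M ] → b ≋ c [ M ] → a ≋ c [ M ]
  ≋-trans {a} {b} {c} (mod e) (mod e′) = mod (subst (M ℤ∣.∣_) (lemma a b c) (ℤ∣.∣m∣n⇒∣m+n e e′))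
    where
    lemma : ∀ a b c → (a ℤ.- b) ℤ.+ (b ℤ.- c) ≡ a ℤ.- c
    lemma = ℤSolver.solve-∀

  ≋-+-cong : ∀ {a b c d} → a ≋ b [ M ] → c ≋ d [ M ] → a ℤ.+ c ≋ b ℤ.+ d [ M ]
  ≋-+-cong {a} {b} {c} {d} (mod e) (mod e′) = mod (subst (M ℤ∣.∣_) (lemma a b c d) (ℤ∣.∣m∣n⇒∣m+n e e′))
    where
    lemma : ∀ a b c d → (a ℤ.- b) ℤ.+ (c ℤ.- d) ≡ (a ℤ.+ c) ℤ.- (b ℤ.+ d)
    lemma = ℤSolver.solve-∀

  ≋-*-cong : ∀ {a b c d} → a ≋ b [ M ] → c ≋ d [ M ] → a ℤ.* c ≋ b ℤ.* d [ M ]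
  ≋-*-cong {a} {b} {c} {d} (mod e) (mod e′) =
    mod (subst (M ℤ∣.∣_) (lemma a b c d) (ℤ∣.∣m∣n⇒∣m+n (ℤ∣.∣m⇒∣m*n c e) (ℤ∣.∣n⇒∣m*n b e′)))
    where
    lemma : ∀ a b c d → (a ℤ.- b) ℤ.* c ℤ.+ b ℤ.* (c ℤ.- d) ≡ a ℤ.* c ℤ.- b ℤ.* d
    lemma = ℤSolver.solve-∀

≋-refl : ∀ {M a} → a ≋ a [ M ]
≋-refl = ≋-reflexive refl

≋-isEquivalence : ∀ M → IsEquivalence (λ a b → a ≋ b [ M ])
≋-isEquivalence M = record { refl = ≋-refl ; sym = ≋-sym ; trans = ≋-trans }

≋-setoid : ℤ → Setoid 0ℓ 0ℓ
≋-setoid M = record { isEquivalence = ≋-isEquivalence M }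

-- (a , b) stands for a + b Z modulo Z² and M.
Dual : Set
Dual = ℤ × ℤ

_⊙_ : Dual → Dual → Dual
(a , b) ⊙ (c , d) = a ℤ.* c , a ℤ.* d ℤ.+ b ℤ.* c

dualMonoid : ℤ → CommutativeMonoid 0ℓ 0ℓ
dualMonoid M = record
  { Carrier = Dual
  ; _≈_     = λ u v → proj₁ u ≋ proj₁ v [ M ] × proj₂ u ≋ proj₂ v [ M ]
  ; _∙_     = _⊙_
  ; ε       = 1ℤ , 0ℤ
  ; isCommutativeMonoid = isCommutativeMonoidˡ record
    { isSemigroup = record
      { isMagma = record
        { isEquivalence = record
          { refl  = ≋-refl , ≋-refl
          ; sym   = λ (e , e′) → ≋-sym e , ≋-sym e′
          ; trans = λ (e , e′) (q , q′) → ≋-trans e q , ≋-trans e′ q′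
          }
        ; ∙-cong = λ (e , e′) (q , q′) → ≋-*-cong e q , ≋-+-cong (≋-*-cong e q′) (≋-*-cong e′ q)
        }
      ; assoc = λ (a , b) (c , d) (e , f) → ≋-reflexive (ℤ.*-assoc a c e) , ≋-reflexive (assoc₂ a b c d e f)
      }
    ; identityˡ = λ (a , b) → ≋-reflexive (ℤ.*-identityˡ a) , ≋-reflexive (identity₂ a b)
    ; comm = λ (a , b) (c , d) → ≋-reflexive (ℤ.*-comm a c) , ≋-reflexive (comm₂ a b c d)
    }
  }
  where
  open import Algebra.Structures.Biased using (isCommutativeMonoidˡ)
  assoc₂ : ∀ a b c d e f → a ℤ.* c ℤ.* f ℤ.+ (a ℤ.* d ℤ.+ b ℤ.* c) ℤ.* e ≡ a ℤ.* (c ℤ.* f ℤ.+ d ℤ.* e) ℤ.+ b ℤ.* (c ℤ.* e)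
  assoc₂ = ℤSolver.solve-∀
  identity₂ : ∀ a b → 1ℤ ℤ.* b ℤ.+ 0ℤ ℤ.* a ≡ b
  identity₂ = ℤSolver.solve-∀
  comm₂ : ∀ a b c d → a ℤ.* d ℤ.+ b ℤ.* c ≡ c ℤ.* b ℤ.+ d ℤ.* a
  comm₂ = ℤSolver.solve-∀

module ℕ∏ = Product *-1-commutativeMonoid
module ℤ∏ = Product ℤ.*-1-commutativeMonoid

pos-∏ : ∀ f n → pos (ℕ∏.∏ f n) ≡ ℤ∏.∏ (pos ∘ f) n
pos-∏ f zero    = refl
pos-∏ f (suc n) = trans (ℤ.pos-* (ℕ∏.∏ f n) (f n)) (cong (ℤ._* pos (f n)) (pos-∏ f n))

∣⇒≋0 : ∀ {M a} → M ℤ∣.∣ a → a ≋ 0ℤ [ M ]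
∣⇒≋0 {M} {a} M∣a = mod (subst (M ℤ∣.∣_) (sym (ℤ.+-identityʳ a)) M∣a)

≋0⇒∣ : ∀ {M a} → a ≋ 0ℤ [ M ] → M ℤ∣.∣ a
≋0⇒∣ {M} {a} (mod M∣a-0) = subst (M ℤ∣.∣_) (ℤ.+-identityʳ a) M∣a-0

∣-resp-≋ : ∀ {M a b} → a ≋ b [ M ] → M ℤ∣.∣ a → M ℤ∣.∣ b
∣-resp-≋ a≋b M∣a = ≋0⇒∣ (≋-trans (≋-sym a≋b) (∣⇒≋0 M∣a))

euclidsLemmaℤ : ∀ {p} → Prime p → ∀ a b → pos p ℤ∣.∣ a ℤ.* b → pos p ℤ∣.∣ a ⊎ pos p ℤ∣.∣ b
euclidsLemmaℤ {p} pr a b p∣ab = Sum.map ℤ∣.∣ᵤ⇒∣ ℤ∣.∣ᵤ⇒∣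
  (euclidsLemma ℤ.∣ a ∣ ℤ.∣ b ∣ pr (subst (p ∣_) (ℤ.abs-* a b) (ℤ∣.∣⇒∣ᵤ p∣ab)))

∤∏ : ∀ {p} → Prime p → ∀ f n → (∀ {i} → i < n → ¬ p ∣ f i) → ¬ p ∣ ℕ∏.∏ f n
∤∏ pr f zero    ∤f p∣1 with refl ← ∣1⇒≡1 p∣1 = contradiction pr λ ()
∤∏ pr f (suc n) ∤f p∣∏ =
  [ ∤∏ pr f n (λ i<n → ∤f (m<n⇒m<1+n i<n)) , ∤f ≤-refl ]′ (euclidsLemma (ℕ∏.∏ f n) (f n) pr p∣∏)

-- Euclid's lemma finds one factor p in b; cancelling it on both sides lowers the exponent by one.
prime-power-cancel : ∀ {p} → Prime p → ∀ j a b → ¬ p ∣ a → p ^ j ∣ a * b → p ^ j ∣ b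
prime-power-cancel pr zero a b p∤a _ = 1∣ b
prime-power-cancel {p} pr (suc j) a b p∤a pʲ⁺¹∣ab
  with euclidsLemma a b pr (m*n∣⇒m∣ p (p ^ j) pʲ⁺¹∣ab)
... | inj₁ p∣a = contradiction p∣a p∤a
... | inj₂ (divides q refl) = subst (p ^ suc j ∣_) (*-comm p q)
        (*-monoʳ-∣ p (prime-power-cancel pr j a q p∤a (*-cancelˡ-∣ p {{prime⇒nonZero pr}} (subst (p ^ suc j ∣_) rearrange pʲ⁺¹∣ab))))
  where
  rearrange : a * (q * p) ≡ p * (a * q)
  rearrange = trans (sym (*-assoc a q p)) (*-comm (a * q) p)

-- The first-order expansion of ∏ (Z + bᵢ), whose linear coefficient is a dual number product.
module _ (M : ℤ) (b : ℕ → ℤ) where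
  open Product (dualMonoid M)

  ∏-dual-constant : ∀ {Z} → M ℤ∣.∣ Z → ∀ n → ℤ∏.∏ (λ i → Z ℤ.+ b i) n ≋ proj₁ (∏ (λ i → b i , 1ℤ) n) [ M ]
  ∏-dual-constant M∣Z zero    = ≋-refl
  ∏-dual-constant M∣Z (suc n) = ≋-*-cong (∏-dual-constant M∣Z n)
    (≋-trans (≋-+-cong (∣⇒≋0 M∣Z) ≋-refl) (≋-reflexive (ℤ.+-identityˡ (b n))))

  -- The factor Z - Z′ is split off exactly and only the cofactor q is reduced modulo M, so that the
  -- powers of p in Z - Z′ and in q can be multiplied.
  ∏-dual-linear : ∀ {Z Z′} → M ℤ∣.∣ Z → M ℤ∣.∣ Z′ → ∀ n → ∃ λ q →
    ℤ∏.∏ (λ i → Z ℤ.+ b i) n ℤ.- ℤ∏.∏ (λ i → Z′ ℤ.+ b i) n ≡ (Z ℤ.- Z′) ℤ.* q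
    × q ≋ proj₂ (∏ (λ i → b i , 1ℤ) n) [ M ]
  ∏-dual-linear {Z} {Z′} M∣Z M∣Z′ zero = 0ℤ , sym (ℤ.*-zeroʳ (Z ℤ.- Z′)) , ≋-refl
  ∏-dual-linear {Z} {Z′} M∣Z M∣Z′ (suc n) with q , P-P′≡ , q≋F₂ ← ∏-dual-linear M∣Z M∣Z′ n =
    -- The product rule for differences, with `1ℤ` kept so that the expression matches the second
    -- component of `⊙` term by term.
    P′ ℤ.* 1ℤ ℤ.+ q ℤ.* (Z ℤ.+ b n) , equation ,
    ≋-+-cong (≋-*-cong (∏-dual-constant M∣Z′ n) ≋-refl)
             (≋-*-cong q≋F₂ (≋-trans (≋-+-cong (∣⇒≋0 M∣Z) ≋-refl) (≋-reflexive (ℤ.+-identityˡ (b n)))))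
    where
    open ≡-Reasoning
    P  = ℤ∏.∏ (λ i → Z ℤ.+ b i) n
    P′ = ℤ∏.∏ (λ i → Z′ ℤ.+ b i) n
    expand : ∀ P P′ Z Z′ b → P ℤ.* (Z ℤ.+ b) ℤ.- P′ ℤ.* (Z′ ℤ.+ b) ≡ (P ℤ.- P′) ℤ.* (Z ℤ.+ b) ℤ.+ P′ ℤ.* (Z ℤ.- Z′)
    expand = ℤSolver.solve-∀
    collect : ∀ D q P′ x → D ℤ.* q ℤ.* x ℤ.+ P′ ℤ.* D ≡ D ℤ.* (P′ ℤ.* 1ℤ ℤ.+ q ℤ.* x)
    collect = ℤSolver.solve-∀
    equation : P ℤ.* (Z ℤ.+ b n) ℤ.- P′ ℤ.* (Z′ ℤ.+ b n) ≡ (Z ℤ.- Z′) ℤ.* (P′ ℤ.* 1ℤ ℤ.+ q ℤ.* (Z ℤ.+ b n))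
    equation = begin
      P ℤ.* (Z ℤ.+ b n) ℤ.- P′ ℤ.* (Z′ ℤ.+ b n)                 ≡⟨ expand P P′ Z Z′ (b n) ⟩
      (P ℤ.- P′) ℤ.* (Z ℤ.+ b n) ℤ.+ P′ ℤ.* (Z ℤ.- Z′)          ≡⟨ cong (λ x → x ℤ.* (Z ℤ.+ b n) ℤ.+ P′ ℤ.* (Z ℤ.- Z′)) P-P′≡ ⟩
      (Z ℤ.- Z′) ℤ.* q ℤ.* (Z ℤ.+ b n) ℤ.+ P′ ℤ.* (Z ℤ.- Z′)    ≡⟨ collect (Z ℤ.- Z′) q P′ (Z ℤ.+ b n) ⟩
      (Z ℤ.- Z′) ℤ.* (P′ ℤ.* 1ℤ ℤ.+ q ℤ.* (Z ℤ.+ b n))          ∎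

  -- The linear coefficient has degree n - 1 in the constants, hence scales by c^(n-1); the extra
  -- factor c on the left avoids that exponent.
  ∏-dual-scale : ∀ c n → let F = ∏ (λ i → b i , 1ℤ) n; G = ∏ (λ i → c ℤ.* b i , 1ℤ) n in
    proj₁ G ≡ c ℤ.^ n ℤ.* proj₁ F × c ℤ.* proj₂ G ≡ c ℤ.^ n ℤ.* proj₂ F
  ∏-dual-scale c zero    = refl , ℤ.*-zeroʳ c
  ∏-dual-scale c (suc n) with ih₁ , ih₂ ← ∏-dual-scale c n =
    trans (cong (ℤ._* (c ℤ.* b n)) ih₁) (first (c ℤ.^ n) F₁ c (b n)) , (begin
      c ℤ.* (G₁ ℤ.* 1ℤ ℤ.+ G₂ ℤ.* (c ℤ.* b n))                                  ≡⟨ expand c G₁ G₂ (b n) ⟩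
      c ℤ.* G₁ ℤ.+ (c ℤ.* G₂) ℤ.* (c ℤ.* b n)                                  ≡⟨ cong₂ (λ x y → c ℤ.* x ℤ.+ y ℤ.* (c ℤ.* b n)) ih₁ ih₂ ⟩
      c ℤ.* (c ℤ.^ n ℤ.* F₁) ℤ.+ (c ℤ.^ n ℤ.* F₂) ℤ.* (c ℤ.* b n)              ≡⟨ collect c (c ℤ.^ n) F₁ F₂ (b n) ⟩
      c ℤ.* c ℤ.^ n ℤ.* (F₁ ℤ.* 1ℤ ℤ.+ F₂ ℤ.* b n)                             ∎)
    where
    open ≡-Reasoning
    F₁ = proj₁ (∏ (λ i → b i , 1ℤ) n)
    F₂ = proj₂ (∏ (λ i → b i , 1ℤ) n)
    G₁ = proj₁ (∏ (λ i → c ℤ.* b i , 1ℤ) n)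
    G₂ = proj₂ (∏ (λ i → c ℤ.* b i , 1ℤ) n)
    first : ∀ k F c b → k ℤ.* F ℤ.* (c ℤ.* b) ≡ c ℤ.* k ℤ.* (F ℤ.* b)
    first = ℤSolver.solve-∀
    expand : ∀ c G₁ G₂ b → c ℤ.* (G₁ ℤ.* 1ℤ ℤ.+ G₂ ℤ.* (c ℤ.* b)) ≡ c ℤ.* G₁ ℤ.+ (c ℤ.* G₂) ℤ.* (c ℤ.* b)
    expand = ℤSolver.solve-∀
    collect : ∀ c k F₁ F₂ b → c ℤ.* (k ℤ.* F₁) ℤ.+ (k ℤ.* F₂) ℤ.* (c ℤ.* b) ≡ c ℤ.* k ℤ.* (F₁ ℤ.* 1ℤ ℤ.+ F₂ ℤ.* b)
    collect = ℤSolver.solve-∀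

-- W h X = (X + 1) ⋯ (X + p - 1) for p = 2h + 1
W : ℕ → ℕ → ℕ
W h X = ℕ∏.∏ (λ i → X + suc i) (h + h)

reflect : ∀ {h i} → i < h → suc (h + (h ∸ suc i)) + suc i ≡ suc (h + h)
reflect {h} {i} i<h = cong suc (trans (+-assoc h (h ∸ suc i) (suc i)) (cong (_+_ h) (m∸n+n≡m i<h)))

-- Pairing X + j with X + p - j makes W a polynomial in Z = X (X + p).
pos-W : ∀ h X → pos (W h X) ≡
  ℤ∏.∏ (λ i → pos X ℤ.* (pos X ℤ.+ pos (suc (h + h))) ℤ.+ pos (suc i) ℤ.* (pos (suc (h + h)) ℤ.- pos (suc i))) h
pos-W h X = trans (pos-∏ (λ i → X + suc i) (h + h))
  (trans (ℤ∏.∏-fold (λ i → pos (X + suc i)) h) (ℤ∏.∏-cong-< h pair))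
  where
  lemma : ∀ x j j′ → (x ℤ.+ j) ℤ.* (x ℤ.+ j′) ≡ x ℤ.* (x ℤ.+ (j′ ℤ.+ j)) ℤ.+ j ℤ.* ((j′ ℤ.+ j) ℤ.- j)
  lemma = ℤSolver.solve-∀
  pair : ∀ {i} → i < h → pos (X + suc i) ℤ.* pos (X + suc (h + (h ∸ suc i))) ≡
    pos X ℤ.* (pos X ℤ.+ pos (suc (h + h))) ℤ.+ pos (suc i) ℤ.* (pos (suc (h + h)) ℤ.- pos (suc i))
  pair {i} i<h = subst (λ s → pos (X + suc i) ℤ.* pos (X + suc (h + (h ∸ suc i))) ≡
    pos X ℤ.* (pos X ℤ.+ s) ℤ.+ pos (suc i) ℤ.* (s ℤ.- pos (suc i)))
    (cong pos (reflect i<h)) (lemma (pos X) (pos (suc i)) (pos (suc (h + (h ∸ suc i)))))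

-- The linear coefficient of W modulo a prime p ≥ 5

module _ (h : ℕ) (pr : Prime (suc (h + h))) (5≤p : 5 ≤ suc (h + h)) where
  private
    p = suc (h + h)
    open Product (dualMonoid (pos p))
    open CommutativeMonoid (dualMonoid (pos p)) using (_≈_; ∙-cong)

    p∤2 : ¬ pos p ℤ∣.∣ pos 2
    p∤2 p∣2 = <⇒≱ 5≤p (≤-trans (∣⇒≤ (ℤ∣.∣⇒∣ᵤ p∣2)) (m≤m+n 2 2))
    p∤3 : ¬ pos p ℤ∣.∣ pos 3
    p∤3 p∣3 = <⇒≱ 5≤p (≤-trans (∣⇒≤ (ℤ∣.∣⇒∣ᵤ p∣3)) (m≤m+n 3 1))

    -- With j = i + 1, these are modulo p the constants j (p - j) of `pos-W`, in a form whose
    -- behaviour under reflection and doubling is plain.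
    -j² : ℕ → ℤ
    -j² i = ℤ.- (pos (suc i) ℤ.* pos (suc i))

    φ : ℕ → Dual
    φ i = -j² i , 1ℤ

    -j²-cong : ∀ {i} {a} → pos (suc i) ≋ a [ pos p ] → -j² i ≋ ℤ.- (a ℤ.* a) [ pos p ]
    -j²-cong {i} {a} i≋a = mod (subst (pos p ℤ∣.∣_) (ℤ.neg-distrib-+ (pos (suc i) ℤ.* pos (suc i)) (ℤ.- (a ℤ.* a)))
      (ℤ∣.∣m⇒∣-m (difference (≋-*-cong i≋a i≋a))))

    φ-periodic : ∀ i → φ (p + i) ≈ φ i
    φ-periodic i = -j²-cong {a = pos (suc i)} (≋-trans (≋-reflexive (cong pos (sym (+-suc p i))))
      (mod (divides 1ℤ (lemma (pos p) (pos (suc i)))))) , ≋-refl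
      where
      lemma : ∀ a b → (a ℤ.+ b) ℤ.- b ≡ 1ℤ ℤ.* a
      lemma = ℤSolver.solve-∀

    φ-reflect : ∀ {i} → i < h → φ (h + (h ∸ suc i)) ≈ φ i
    φ-reflect {i} i<h = ≋-trans (-j²-cong {a = ℤ.- pos (suc i)} (mod (divides 1ℤ (begin
      pos (suc (h + (h ∸ suc i))) ℤ.- ℤ.- pos (suc i)   ≡⟨ cong (ℤ._+_ (pos (suc (h + (h ∸ suc i))))) (ℤ.neg-involutive (pos (suc i))) ⟩
      pos (suc (h + (h ∸ suc i)) + suc i)               ≡⟨ cong pos (reflect i<h) ⟩
      pos p                                             ≡⟨ ℤ.*-identityˡ (pos p) ⟨
      1ℤ ℤ.* pos p                                      ∎))))
      (≋-reflexive (lemma (pos (suc i)))) , ≋-refl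
      where
      open ≡-Reasoning
      lemma : ∀ a → ℤ.- (ℤ.- a ℤ.* ℤ.- a) ≡ ℤ.- (a ℤ.* a)
      lemma = ℤSolver.solve-∀

    φ-double : ∀ i → φ (suc (i + i)) ≡ (pos 4 ℤ.* -j² i , 1ℤ)
    φ-double i = cong (_, 1ℤ) (trans (cong (λ a → ℤ.- (a ℤ.* a)) (cong (pos ∘ suc) (sym (+-suc i i)))) (lemma (pos (suc i))))
      where
      lemma : ∀ a → ℤ.- ((a ℤ.+ a) ℤ.* (a ℤ.+ a)) ≡ pos 4 ℤ.* ℤ.- (a ℤ.* a)
      lemma = ℤSolver.solve-∀

    -- `E` runs over all nonzero residues, which doubling permutes. `F` takes one residue from each
    -- pair j, p - j and carries the expansion of W.
    E F : Dual
    E = ∏ φ (h + h)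
    F = ∏ φ h

    -- The residues j and p - j have the same square.
    E≈F² : E ≈ F ⊙ F
    E≈F² = begin
      ∏ φ (h + h)                                   ≈⟨ ∏-fold φ h ⟩
      ∏ (λ i → φ i ⊙ φ (h + (h ∸ suc i))) h         ≈⟨ ∏-cong-< h (λ {i} i<h → ∙-cong {φ i} {φ i} (≋-refl , ≋-refl) (φ-reflect i<h)) ⟩
      ∏ (λ i → φ i ⊙ φ i) h                         ≈⟨ ∏-∙ φ φ h ⟩
      F ⊙ F                                         ∎
      where open ≈-Reasoning (CommutativeMonoid.setoid (dualMonoid (pos p)))

    -- Comparing E with its image under doubling: 4 E₁ E₂ ≡ 4^(p-1) E₁ E₂ ≡ E₁ E₂.
    p∣3E₁E₂ : pos p ℤ∣.∣ pos 3 ℤ.* (proj₁ E ℤ.* proj₂ E)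
    p∣3E₁E₂ = subst (pos p ℤ∣.∣_) (lemma (proj₁ E) (proj₂ E)) (difference (begin
      proj₁ E ℤ.* (pos 4 ℤ.* proj₂ E)            ≈⟨ ≋-*-cong (≋-refl {a = proj₁ E}) (≋-*-cong (≋-refl {a = pos 4}) (proj₂ G≈E)) ⟨
      proj₁ E ℤ.* (pos 4 ℤ.* proj₂ G)            ≡⟨ cong (ℤ._*_ (proj₁ E)) (proj₂ scale) ⟩
      proj₁ E ℤ.* (4ⁿ ℤ.* proj₂ E)               ≡⟨ swap (proj₁ E) 4ⁿ (proj₂ E) ⟩
      4ⁿ ℤ.* proj₁ E ℤ.* proj₂ E                 ≡⟨ cong (ℤ._* proj₂ E) (proj₁ scale) ⟨
      proj₁ G ℤ.* proj₂ E                        ≈⟨ ≋-*-cong (proj₁ G≈E) ≋-refl ⟩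
      proj₁ E ℤ.* proj₂ E                        ∎))
      where
      open ≈-Reasoning (≋-setoid (pos p))
      4ⁿ = pos 4 ℤ.^ (h + h)
      G = ∏ (λ i → pos 4 ℤ.* -j² i , 1ℤ) (h + h)
      scale = ∏-dual-scale (pos p) -j² (pos 4) (h + h)
      G≈E : G ≈ E
      G≈E = CommutativeMonoid.trans (dualMonoid (pos p)) {G}
        (∏-cong (h + h) (λ i → CommutativeMonoid.reflexive (dualMonoid (pos p)) (sym (φ-double i))))
        (∏-doubling φ h φ-periodic)
      swap : ∀ a b c → a ℤ.* (b ℤ.* c) ≡ b ℤ.* a ℤ.* c
      swap = ℤSolver.solve-∀
      lemma : ∀ a b → a ℤ.* (pos 4 ℤ.* b) ℤ.- a ℤ.* b ≡ pos 3 ℤ.* (a ℤ.* b)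
      lemma = ℤSolver.solve-∀

    -- The constant coefficient is a product of factors -j² with 1 ≤ j ≤ h < p.
    p∤F₁ : ∀ n → n ≤ h → ¬ pos p ℤ∣.∣ proj₁ (∏ φ n)
    p∤F₁ zero    _   p∣1 = <⇒≱ 5≤p (≤-trans (∣⇒≤ (ℤ∣.∣⇒∣ᵤ p∣1)) (m≤m+n 1 3))
    p∤F₁ (suc n) n<h p∣  with euclidsLemmaℤ pr (proj₁ (∏ φ n)) (-j² n) p∣
    ... | inj₁ p∣∏ = p∤F₁ n (<⇒≤ n<h) p∣∏
    ... | inj₂ p∣-j² = [ absurd , absurd ]′ (euclidsLemmaℤ pr (pos (suc n)) (pos (suc n))
            (subst (pos p ℤ∣.∣_) (ℤ.neg-involutive (pos (suc n) ℤ.* pos (suc n))) (ℤ∣.∣m⇒∣-m p∣-j²)))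
      where
      absurd : ¬ pos p ℤ∣.∣ pos (suc n)
      absurd p∣j = <⇒≱ (s≤s (≤-trans n<h (m≤m+n h h))) (∣⇒≤ (ℤ∣.∣⇒∣ᵤ p∣j))

    -- Squaring gives E₁ = F₁² and E₂ = 2 F₁ F₂ modulo p, so p divides 6 F₁³ F₂; as p ≥ 5, it
    -- divides none of 2, 3 and F₁.
    p∣F₂ : pos p ℤ∣.∣ proj₂ F
    p∣F₂ = cancel F₁∤ (cancel F₁∤ (cancel F₁∤ (cancel p∤2 (cancel p∤3
      (subst (pos p ℤ∣.∣_) (lemma F₁ F₂)
        (∣-resp-≋ (≋-*-cong (≋-refl {a = pos 3}) (≋-*-cong (proj₁ E≈F²) (proj₂ E≈F²))) p∣3E₁E₂))))))
      where
      F₁ = proj₁ F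
      F₂ = proj₂ F
      F₁∤ = p∤F₁ h ≤-refl
      cancel : ∀ {a b} → ¬ pos p ℤ∣.∣ a → pos p ℤ∣.∣ a ℤ.* b → pos p ℤ∣.∣ b
      cancel {a} {b} ∤a ∣ab = [ (λ ∣a → contradiction ∣a ∤a) , id ]′ (euclidsLemmaℤ pr a b ∣ab)
      lemma : ∀ a b → pos 3 ℤ.* (a ℤ.* a ℤ.* (a ℤ.* b ℤ.+ b ℤ.* a)) ≡ pos 3 ℤ.* (pos 2 ℤ.* (a ℤ.* (a ℤ.* (a ℤ.* b))))
      lemma = ℤSolver.solve-∀

    ψ : ℕ → ℤ
    ψ i = pos (suc i) ℤ.* (pos p ℤ.- pos (suc i))

    Z : ℕ → ℤ
    Z X = pos X ℤ.* (pos X ℤ.+ pos p)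

    p∣Z : ∀ {X} → p ∣ X → pos p ℤ∣.∣ Z X
    p∣Z {X} p∣X = ℤ∣.∣m⇒∣m*n {m = pos X} (pos X ℤ.+ pos p) (ℤ∣.∣ᵤ⇒∣ p∣X)

    p∣linear-coefficient : pos p ℤ∣.∣ proj₂ (∏ (λ i → ψ i , 1ℤ) h)
    p∣linear-coefficient = ∣-resp-≋ (proj₂ (∏-cong h φ≈ψ)) p∣F₂
      where
      lemma : ∀ j p → ℤ.- (j ℤ.* j) ℤ.- j ℤ.* (p ℤ.- j) ≡ ℤ.- j ℤ.* p
      lemma = ℤSolver.solve-∀
      φ≈ψ : ∀ i → φ i ≈ (ψ i , 1ℤ)
      φ≈ψ i = mod (divides (ℤ.- pos (suc i)) (lemma (pos (suc i)) (pos p))) , ≋-refl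

    -- Here x (x + P) - y (y + P) = (x - y) (x + y + P) = P² m (m + 2t + 1), and the cofactor q
    -- brings the third factor P.
    cubic : ∀ {P m t x y A B L} → x ≡ P ℤ.* m ℤ.+ P ℤ.* t → y ≡ P ℤ.* t →
            (∃ λ q → A ℤ.- B ≡ (x ℤ.* (x ℤ.+ P) ℤ.- y ℤ.* (y ℤ.+ P)) ℤ.* q × q ≋ L [ P ]) → P ℤ∣.∣ L →
            A ≋ B [ P ℤ.* P ℤ.* P ℤ.* m ]
    cubic {P} {m} {t} refl refl (q , A-B≡ , q≋L) P∣L with divides r refl ← ∣-resp-≋ (≋-sym q≋L) P∣L =
      mod (divides ((m ℤ.+ pos 2 ℤ.* t ℤ.+ 1ℤ) ℤ.* r) (trans A-B≡ (lemma P m t r)))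
      where
      lemma : ∀ P m t r →
        ((P ℤ.* m ℤ.+ P ℤ.* t) ℤ.* (P ℤ.* m ℤ.+ P ℤ.* t ℤ.+ P) ℤ.- P ℤ.* t ℤ.* (P ℤ.* t ℤ.+ P)) ℤ.* (r ℤ.* P)
        ≡ (m ℤ.+ pos 2 ℤ.* t ℤ.+ 1ℤ) ℤ.* r ℤ.* (P ℤ.* P ℤ.* P ℤ.* m)
      lemma = ℤSolver.solve-∀

  W-≋ : ∀ m t → pos (W h (p * m + p * t)) ≋ pos (W h (p * t)) [ pos p ℤ.* pos p ℤ.* pos p ℤ.* pos m ]
  W-≋ m t = subst₂ (λ a b → a ≋ b [ pos p ℤ.* pos p ℤ.* pos p ℤ.* pos m ])
    (sym (pos-W h (p * m + p * t))) (sym (pos-W h (p * t)))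
    (cubic {pos p} {pos m} {pos t} {pos (p * m + p * t)} {pos (p * t)}
      (cong₂ ℤ._+_ (ℤ.pos-* p m) (ℤ.pos-* p t)) (ℤ.pos-* p t)
      (∏-dual-linear (pos p) ψ (p∣Z (∣m∣n⇒∣m+n (m∣m*n m) (m∣m*n t))) (p∣Z (m∣m*n t)) h)
      p∣linear-coefficient)

-- Multiset coefficients

⊛-congʳ-≋ : ∀ {M} f g g′ n → (∀ j → pos (g j) ≋ pos (g′ j) [ M ]) → pos ((f ⊛ g) n) ≋ pos ((f ⊛ g′) n) [ M ]
⊛-congʳ-≋ {M} f g g′ zero g≋ = begin
  pos ((f ⊛ g) 0)         ≡⟨ cong pos (⊛-zero f g) ⟩
  pos (f 0 * g 0)         ≡⟨ ℤ.pos-* (f 0) (g 0) ⟩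
  pos (f 0) ℤ.* pos (g 0)   ≈⟨ ≋-*-cong (≋-refl {a = pos (f 0)}) (g≋ 0) ⟩
  pos (f 0) ℤ.* pos (g′ 0)  ≡⟨ ℤ.pos-* (f 0) (g′ 0) ⟨
  pos (f 0 * g′ 0)        ≡⟨ cong pos (⊛-zero f g′) ⟨
  pos ((f ⊛ g′) 0)        ∎
  where open ≈-Reasoning (≋-setoid M)
⊛-congʳ-≋ {M} f g g′ (suc n) g≋ = begin
  pos ((f ⊛ g) (suc n))
    ≡⟨ cong pos (⊛-suc f g n) ⟩
  pos (f 0 * g (suc n)) ℤ.+ pos (((f ∘ suc) ⊛ g) n)
    ≡⟨ cong (ℤ._+ pos (((f ∘ suc) ⊛ g) n)) (ℤ.pos-* (f 0) (g (suc n))) ⟩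
  pos (f 0) ℤ.* pos (g (suc n)) ℤ.+ pos (((f ∘ suc) ⊛ g) n)
    ≈⟨ ≋-+-cong (≋-*-cong (≋-refl {a = pos (f 0)}) (g≋ (suc n))) (⊛-congʳ-≋ (f ∘ suc) g g′ n g≋) ⟩
  pos (f 0) ℤ.* pos (g′ (suc n)) ℤ.+ pos (((f ∘ suc) ⊛ g′) n)
    ≡⟨ cong (ℤ._+ pos (((f ∘ suc) ⊛ g′) n)) (ℤ.pos-* (f 0) (g′ (suc n))) ⟨
  pos (f 0 * g′ (suc n)) ℤ.+ pos (((f ∘ suc) ⊛ g′) n)
    ≡⟨ cong pos (⊛-suc f g′ n) ⟨
  pos ((f ⊛ g′) (suc n)) ∎
  where open ≈-Reasoning (≋-setoid M)

multichoose : ℕ → ℕ → ℕ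
multichoose r n = (geom 1 ^ˢ r) n

multichoose-zero : ∀ r → multichoose r 0 ≡ 1
multichoose-zero zero    = refl
multichoose-zero (suc r) = trans (⊛-zero (geom 1) (geom 1 ^ˢ r)) (trans (*-identityˡ _) (multichoose-zero r))

multichoose-pascal : ∀ r n → multichoose (suc r) (suc n) ≡ multichoose r (suc n) + multichoose (suc r) n
multichoose-pascal r n = begin
  multichoose (suc r) (suc n)
    ≡⟨ ⊛-suc (geom 1) (geom 1 ^ˢ r) n ⟩
  1 * multichoose r (suc n) + ((geom 1 ∘ suc) ⊛ (geom 1 ^ˢ r)) n
    ≡⟨ cong₂ _+_ (*-identityˡ (multichoose r (suc n)))
         (⊛-cong {f′ = geom 1} {g = geom 1 ^ˢ r} (λ k → trans (geom-∣ (1∣ suc k)) (sym (geom-∣ (1∣ k)))) (λ _ → refl) n) ⟩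
  multichoose r (suc n) + multichoose (suc r) n ∎
  where open ≡-Reasoning

-- Both absorption identities are proved together: Pascal's rule reduces either one to the pair of
-- them with r or n lowered by one.
multichoose-absorbʳ : ∀ r n → suc n * multichoose r (suc n) ≡ (r + n) * multichoose r n
multichoose-absorbˡ : ∀ r n → r * multichoose (suc r) n ≡ (r + n) * multichoose r n

multichoose-absorbʳ zero zero    = refl
multichoose-absorbʳ zero (suc n) = trans (*-zeroʳ n) (sym (*-zeroʳ n))
multichoose-absorbʳ (suc r) n = begin
  suc n * multichoose (suc r) (suc n)
    ≡⟨ cong (suc n *_) (multichoose-pascal r n) ⟩
  suc n * (multichoose r (suc n) + multichoose (suc r) n)
    ≡⟨ *-distribˡ-+ (suc n) (multichoose r (suc n)) _ ⟩
  suc n * multichoose r (suc n) + suc n * multichoose (suc r) n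
    ≡⟨ cong (_+ suc n * multichoose (suc r) n) (trans (multichoose-absorbʳ r n) (sym (multichoose-absorbˡ r n))) ⟩
  r * multichoose (suc r) n + suc n * multichoose (suc r) n
    ≡⟨ *-distribʳ-+ (multichoose (suc r) n) r (suc n) ⟨
  (r + suc n) * multichoose (suc r) n
    ≡⟨ cong (_* multichoose (suc r) n) (+-suc r n) ⟩
  (suc r + n) * multichoose (suc r) n ∎
  where open ≡-Reasoning

multichoose-absorbˡ r zero = begin
  r * multichoose (suc r) 0    ≡⟨ cong (r *_) (trans (multichoose-zero (suc r)) (sym (multichoose-zero r))) ⟩
  r * multichoose r 0          ≡⟨ cong (_* multichoose r 0) (+-identityʳ r) ⟨
  (r + 0) * multichoose r 0    ∎
  where open ≡-Reasoning
multichoose-absorbˡ r (suc n) = begin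
  r * multichoose (suc r) (suc n)
    ≡⟨ cong (r *_) (multichoose-pascal r n) ⟩
  r * (multichoose r (suc n) + multichoose (suc r) n)
    ≡⟨ *-distribˡ-+ r (multichoose r (suc n)) _ ⟩
  r * multichoose r (suc n) + r * multichoose (suc r) n
    ≡⟨ cong (r * multichoose r (suc n) +_) (trans (multichoose-absorbˡ r n) (sym (multichoose-absorbʳ r n))) ⟩
  r * multichoose r (suc n) + suc n * multichoose r (suc n)
    ≡⟨ *-distribʳ-+ (multichoose r (suc n)) r (suc n) ⟨
  (r + suc n) * multichoose r (suc n) ∎
  where open ≡-Reasoning

-- The ratio of the two multiset coefficients

-- Iterates `multichoose-absorbʳ`. The factor r + N stands apart because for r = p m, N = p n and j
-- = p - 1 it is the only multiple of p on the right, and the rest is a value of `W`.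
multichoose-rising : ∀ r N j →
  multichoose r (N + suc j) * ℕ∏.∏ (λ i → N + suc i) (suc j) ≡
  multichoose r N * ((r + N) * ℕ∏.∏ (λ i → (r + N) + suc i) j)
multichoose-rising r N zero = begin
  multichoose r (N + 1) * (1 * (N + 1))       ≡⟨ cong (λ x → multichoose r x * (1 * x)) (+-comm N 1) ⟩
  multichoose r (suc N) * (1 * suc N)         ≡⟨ cong (multichoose r (suc N) *_) (*-identityˡ (suc N)) ⟩
  multichoose r (suc N) * suc N               ≡⟨ *-comm (multichoose r (suc N)) (suc N) ⟩
  suc N * multichoose r (suc N)               ≡⟨ multichoose-absorbʳ r N ⟩
  (r + N) * multichoose r N                   ≡⟨ *-comm (r + N) _ ⟩
  multichoose r N * (r + N)                   ≡⟨ cong (multichoose r N *_) (*-identityʳ (r + N)) ⟨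
  multichoose r N * ((r + N) * 1)             ∎
  where open ≡-Reasoning
multichoose-rising r N (suc j) = begin
  multichoose r (N + suc (suc j)) * (P * (N + suc (suc j)))
    ≡⟨ cong (λ x → multichoose r x * (P * x)) (+-suc N (suc j)) ⟩
  multichoose r (suc N′) * (P * suc N′)
    ≡⟨ move (multichoose r (suc N′)) P (suc N′) ⟩
  suc N′ * multichoose r (suc N′) * P
    ≡⟨ cong (_* P) (multichoose-absorbʳ r N′) ⟩
  (r + N′) * multichoose r N′ * P
    ≡⟨ *-assoc (r + N′) (multichoose r N′) P ⟩
  (r + N′) * (multichoose r N′ * P)
    ≡⟨ cong₂ _*_ (sym (+-assoc r N (suc j))) (multichoose-rising r N j) ⟩
  (r + N + suc j) * (multichoose r N * ((r + N) * R))
    ≡⟨ collect (r + N + suc j) (multichoose r N) (r + N) R ⟩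
  multichoose r N * ((r + N) * (R * (r + N + suc j))) ∎
  where
  open ≡-Reasoning
  N′ = N + suc j
  P = ℕ∏.∏ (λ i → N + suc i) (suc j)
  R = ℕ∏.∏ (λ i → (r + N) + suc i) j
  move : ∀ a b c → a * (b * c) ≡ c * a * b
  move = solve-∀
  collect : ∀ a b c d → a * (b * (c * d)) ≡ b * (c * (d * a))
  collect = solve-∀

-- The product of X + i over the i < p n prime to p.
Q : ℕ → ℕ → ℕ → ℕ
Q h X n = ℕ∏.∏ (λ t → W h (X + suc (h + h) * t)) n

-- From n to n + 1 the left coefficient gains p factors above and below. The multiples of p among
-- them give (m + n) / (n + 1), the step of `multichoose m n`; the others give the step of `Q`.
multichoose-Q : ∀ h m n → let p = suc (h + h) in
  multichoose (p * m) (p * n) * Q h 0 n ≡ multichoose m n * Q h (p * m) n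
multichoose-Q h m zero = cong (_* 1) (trans (cong (multichoose (p * m)) (*-zeroʳ p))
    (trans (multichoose-zero (p * m)) (sym (multichoose-zero m))))
  where p = suc (h + h)
-- The factor p (n + 1) is the one that `Q` omits; supplying it completes the product in
-- `multichoose-rising`.
multichoose-Q h m (suc n) = *-cancelˡ-≡ _ _ (p * suc n) {{m*n≢0 p (suc n)}} (begin
  p * suc n * (multichoose (p * m) (p * suc n) * (Q₀ * W h (p * n)))
    ≡⟨ cong (λ x → x * (multichoose (p * m) x * (Q₀ * W h (p * n)))) (trans (*-suc p n) (+-comm p (p * n))) ⟩
  (p * n + p) * (multichoose (p * m) (p * n + p) * (Q₀ * W h (p * n)))
    ≡⟨ move (p * n + p) (multichoose (p * m) (p * n + p)) Q₀ (W h (p * n)) ⟩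
  Q₀ * (multichoose (p * m) (p * n + p) * (W h (p * n) * (p * n + p)))
    ≡⟨ cong (Q₀ *_) (multichoose-rising (p * m) (p * n) (h + h)) ⟩
  Q₀ * (multichoose (p * m) (p * n) * ((p * m + p * n) * W′))
    ≡⟨ cong (λ x → Q₀ * (multichoose (p * m) (p * n) * (x * W′))) (*-distribˡ-+ p m n) ⟨
  Q₀ * (multichoose (p * m) (p * n) * (p * (m + n) * W′))
    ≡⟨ assocs Q₀ (multichoose (p * m) (p * n)) p (m + n) W′ ⟩
  (multichoose (p * m) (p * n) * Q₀) * (p * (m + n) * W′)
    ≡⟨ cong (_* (p * (m + n) * W′)) (multichoose-Q h m n) ⟩
  (multichoose m n * Q₁) * (p * (m + n) * W′)
    ≡⟨ group (multichoose m n) Q₁ p (m + n) W′ ⟩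
  p * ((m + n) * multichoose m n) * (Q₁ * W′)
    ≡⟨ cong (λ x → p * x * (Q₁ * W′)) (multichoose-absorbʳ m n) ⟨
  p * (suc n * multichoose m (suc n)) * (Q₁ * W′)
    ≡⟨ final p (suc n) (multichoose m (suc n)) (Q₁ * W′) ⟩
  p * suc n * (multichoose m (suc n) * (Q₁ * W′)) ∎)
  where
  open ≡-Reasoning
  p = suc (h + h)
  Q₀ = Q h 0 n
  Q₁ = Q h (p * m) n
  W′ = W h (p * m + p * n)
  move : ∀ a b c d → a * (b * (c * d)) ≡ c * (b * (d * a))
  move = solve-∀
  assocs : ∀ a b c d e → a * (b * (c * d * e)) ≡ (b * a) * (c * d * e)
  assocs = solve-∀
  group : ∀ a b c d e → (a * b) * (c * d * e) ≡ c * (d * a) * (b * e)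
  group = solve-∀
  final : ∀ a b c d → a * (b * c) * d ≡ a * b * (c * d)
  final = solve-∀

-- Every factor is p t + j with 0 < j < p.
∤Q : ∀ h → Prime (suc (h + h)) → ∀ n → ¬ suc (h + h) ∣ Q h 0 n
∤Q h pr n = ∤∏ pr _ n (λ {t} _ → ∤∏ pr _ (h + h) (λ {i} i<2h p∣ →
  <⇒≱ (s<s i<2h) (∣⇒≤ (∣m+n∣m⇒∣n p∣ (m∣m*n {suc (h + h)} t)))))

-- Calculating modulo p³ m keeps the valuation k out of sight until `power∣modulus`.
modulus : ℕ → ℕ → ℤ
modulus p m = pos p ℤ.* pos p ℤ.* pos p ℤ.* pos m

power∣modulus : ∀ p m k → p ^ k ∣ m → pos (p ^ (k + 3)) ℤ∣.∣ modulus p m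
power∣modulus p m k pᵏ∣m = subst (pos (p ^ (k + 3)) ℤ∣.∣_) cast (ℤ∣.∣ᵤ⇒∣ (subst (_∣ p * p * p * m) power (*-monoʳ-∣ (p * p * p) pᵏ∣m)))
  where
  open ≡-Reasoning
  cubed : ∀ p x → p * p * p * x ≡ x * (p * (p * (p * 1)))
  cubed = solve-∀
  power : p * p * p * p ^ k ≡ p ^ (k + 3)
  power = trans (cubed p (p ^ k)) (sym (^-distribˡ-+-* p k 3))
  cast : pos (p * p * p * m) ≡ modulus p m
  cast = begin
    pos (p * p * p * m)                    ≡⟨ ℤ.pos-* (p * p * p) m ⟩
    pos (p * p * p) ℤ.* pos m              ≡⟨ cong (ℤ._* pos m) (ℤ.pos-* (p * p) p) ⟩
    pos (p * p) ℤ.* pos p ℤ.* pos m        ≡⟨ cong (λ x → x ℤ.* pos p ℤ.* pos m) (ℤ.pos-* p p) ⟩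
    modulus p m                            ∎

-- By `multichoose-Q` the hypothesis says that p³ m divides Q(0) times the difference sought, and
-- Q(0) is prime to p. It keeps the factor `multichoose m n` because for p = 3 this factor supplies
-- the missing 3.
multichoose-≋ : ∀ h → Prime (suc (h + h)) → let p = suc (h + h) in ∀ m k n → p ^ k ∣ m →
  pos (multichoose m n) ℤ.* pos (Q h (p * m) n) ≋ pos (multichoose m n) ℤ.* pos (Q h 0 n) [ modulus p m ] →
  pos (multichoose (p * m) (p * n)) ≋ pos (multichoose m n) [ pos (p ^ (k + 3)) ]
multichoose-≋ h pr m k n pᵏ∣m (mod e) = mod (ℤ∣.∣ᵤ⇒∣
  (prime-power-cancel pr (k + 3) (Q h 0 n) ℤ.∣ Δ ∣ (∤Q h pr n)
    (subst (p ^ (k + 3) ∣_) (ℤ.abs-* (pos (Q h 0 n)) Δ)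
      (ℤ∣.∣⇒∣ᵤ {i = pos (Q h 0 n) ℤ.* Δ} (ℤ∣.∣-trans (power∣modulus p m k pᵏ∣m) (subst (modulus p m ℤ∣.∣_) rearrange e))))))
  where
  open ≡-Reasoning
  p = suc (h + h)
  a = pos (multichoose (p * m) (p * n))
  b = pos (multichoose m n)
  Δ = a ℤ.- b
  factor : ∀ a b c → a ℤ.* c ℤ.- b ℤ.* c ≡ c ℤ.* (a ℤ.- b)
  factor = ℤSolver.solve-∀
  rearrange : b ℤ.* pos (Q h (p * m) n) ℤ.- b ℤ.* pos (Q h 0 n) ≡ pos (Q h 0 n) ℤ.* Δ
  rearrange = begin
    b ℤ.* pos (Q h (p * m) n) ℤ.- b ℤ.* pos (Q h 0 n)
      ≡⟨ cong (ℤ._- b ℤ.* pos (Q h 0 n)) (trans (sym (ℤ.pos-* (multichoose m n) (Q h (p * m) n)))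
           (trans (cong pos (sym (multichoose-Q h m n))) (ℤ.pos-* (multichoose (p * m) (p * n)) (Q h 0 n)))) ⟩
    a ℤ.* pos (Q h 0 n) ℤ.- b ℤ.* pos (Q h 0 n)
      ≡⟨ factor a b (pos (Q h 0 n)) ⟩
    pos (Q h 0 n) ℤ.* Δ ∎

Q-≋ : ∀ h → Prime (suc (h + h)) → 5 ≤ suc (h + h) → let p = suc (h + h) in
  ∀ m n → pos (Q h (p * m) n) ≋ pos (Q h 0 n) [ modulus p m ]
Q-≋ h pr 5≤p m n = subst₂ (λ a b → a ≋ b [ modulus p m ])
  (sym (pos-∏ (λ t → W h (p * m + p * t)) n)) (sym (pos-∏ (λ t → W h (p * t)) n)) (go n)
  where
  p = suc (h + h)
  go : ∀ n → ℤ∏.∏ (λ t → pos (W h (p * m + p * t))) n ≋ ℤ∏.∏ (λ t → pos (W h (p * t))) n [ modulus p m ]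
  go zero    = ≋-refl
  go (suc n) = ≋-*-cong (go n) (W-≋ h pr 5≤p m n)

-- The correction factor for p = 3

module _ (m : ℕ) (3∣m : 3 ∣ m) where
  private
    m′ = quotient 3∣m

    m≡ : pos m ≡ pos m′ ℤ.* pos 3
    m≡ = trans (cong pos (_∣_.equality 3∣m)) (ℤ.pos-* m′ 3)

    pos-W₁ : ∀ X → pos (W 1 X) ≡ (pos X ℤ.+ 1ℤ) ℤ.* (pos X ℤ.+ pos 2)
    pos-W₁ X = trans (pos-∏ (λ i → X + suc i) 2) (cong (ℤ._* pos (X + 2)) (ℤ.*-identityˡ (pos (X + 1))))

    -- The values differ by 9 m (m + 2t + 1), where 9 m² vanishes modulo 27 m because 3 divides m.
    -- Since (y + 1) (y + 2) ≡ -1 modulo 3, the remaining 9 m (2t + 1) can be written as a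
    -- multiplicative correction.
    W₁-≋ : ∀ {m m′ t x y} → m ≡ m′ ℤ.* pos 3 → x ≡ pos 3 ℤ.* m ℤ.+ pos 3 ℤ.* t → y ≡ pos 3 ℤ.* t →
           (x ℤ.+ 1ℤ) ℤ.* (x ℤ.+ pos 2) ≋
           (y ℤ.+ 1ℤ) ℤ.* (y ℤ.+ pos 2) ℤ.* (1ℤ ℤ.- pos 9 ℤ.* m ℤ.* (pos 2 ℤ.* t ℤ.+ 1ℤ))
           [ pos 3 ℤ.* pos 3 ℤ.* pos 3 ℤ.* m ]
    W₁-≋ {m′ = m′} {t} refl refl refl =
      mod (divides (m′ ℤ.+ (pos 2 ℤ.* t ℤ.+ 1ℤ) ℤ.* (pos 3 ℤ.* t ℤ.* t ℤ.+ pos 3 ℤ.* t ℤ.+ 1ℤ)) (lemma m′ t))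
      where
      lemma : ∀ m′ t → let m = m′ ℤ.* pos 3; x = pos 3 ℤ.* m ℤ.+ pos 3 ℤ.* t; y = pos 3 ℤ.* t in
        (x ℤ.+ 1ℤ) ℤ.* (x ℤ.+ pos 2)
          ℤ.- (y ℤ.+ 1ℤ) ℤ.* (y ℤ.+ pos 2) ℤ.* (1ℤ ℤ.- pos 9 ℤ.* m ℤ.* (pos 2 ℤ.* t ℤ.+ 1ℤ))
        ≡ (m′ ℤ.+ (pos 2 ℤ.* t ℤ.+ 1ℤ) ℤ.* (pos 3 ℤ.* t ℤ.* t ℤ.+ pos 3 ℤ.* t ℤ.+ 1ℤ)) ℤ.* (pos 3 ℤ.* pos 3 ℤ.* pos 3 ℤ.* m)
      lemma = ℤSolver.solve-∀

    -- The corrections add up by n² + (2n + 1) = (n + 1)², and the cross term 81 m² n² (2n + 1) is a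
    -- multiple of 27 m.
    sum-of-odds : ∀ m n → (1ℤ ℤ.- pos 9 ℤ.* m ℤ.* (n ℤ.* n)) ℤ.* (1ℤ ℤ.- pos 9 ℤ.* m ℤ.* (pos 2 ℤ.* n ℤ.+ 1ℤ))
      ≋ 1ℤ ℤ.- pos 9 ℤ.* m ℤ.* ((1ℤ ℤ.+ n) ℤ.* (1ℤ ℤ.+ n)) [ pos 3 ℤ.* pos 3 ℤ.* pos 3 ℤ.* m ]
    sum-of-odds m n = mod (divides (pos 3 ℤ.* m ℤ.* (n ℤ.* n) ℤ.* (pos 2 ℤ.* n ℤ.+ 1ℤ)) (lemma m n))
      where
      lemma : ∀ m n → (1ℤ ℤ.- pos 9 ℤ.* m ℤ.* (n ℤ.* n)) ℤ.* (1ℤ ℤ.- pos 9 ℤ.* m ℤ.* (pos 2 ℤ.* n ℤ.+ 1ℤ))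
        ℤ.- (1ℤ ℤ.- pos 9 ℤ.* m ℤ.* ((1ℤ ℤ.+ n) ℤ.* (1ℤ ℤ.+ n)))
        ≡ pos 3 ℤ.* m ℤ.* (n ℤ.* n) ℤ.* (pos 2 ℤ.* n ℤ.+ 1ℤ) ℤ.* (pos 3 ℤ.* pos 3 ℤ.* pos 3 ℤ.* m)
      lemma = ℤSolver.solve-∀

  Q₁-≋ : ∀ n → pos (Q 1 (3 * m) n) ≋ pos (Q 1 0 n) ℤ.* (1ℤ ℤ.- pos 9 ℤ.* pos m ℤ.* (pos n ℤ.* pos n)) [ modulus 3 m ]
  Q₁-≋ zero    = ≋-reflexive (lemma (pos m))
    where
    lemma : ∀ m → 1ℤ ≡ 1ℤ ℤ.* (1ℤ ℤ.- pos 9 ℤ.* m ℤ.* (0ℤ ℤ.* 0ℤ))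
    lemma = ℤSolver.solve-∀
  Q₁-≋ (suc n) = begin
    pos (Q 1 (3 * m) n * W 1 (3 * m + 3 * n))
      ≡⟨ ℤ.pos-* (Q 1 (3 * m) n) (W 1 (3 * m + 3 * n)) ⟩
    pos (Q 1 (3 * m) n) ℤ.* pos (W 1 (3 * m + 3 * n))
      ≈⟨ ≋-*-cong (Q₁-≋ n) (subst₂ (λ a b → a ≋ b ℤ.* w [ modulus 3 m ]) (sym (pos-W₁ (3 * m + 3 * n))) (sym (pos-W₁ (3 * n)))
           (W₁-≋ {m′ = pos m′} {t = pos n} m≡ (cong₂ ℤ._+_ (ℤ.pos-* 3 m) (ℤ.pos-* 3 n)) (ℤ.pos-* 3 n))) ⟩
    pos (Q 1 0 n) ℤ.* v ℤ.* (pos (W 1 (3 * n)) ℤ.* w)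
      ≡⟨ interchange (pos (Q 1 0 n)) v (pos (W 1 (3 * n))) w ⟩
    pos (Q 1 0 n) ℤ.* pos (W 1 (3 * n)) ℤ.* (v ℤ.* w)
      ≈⟨ ≋-*-cong (≋-reflexive (sym (ℤ.pos-* (Q 1 0 n) (W 1 (3 * n))))) (sum-of-odds (pos m) (pos n)) ⟩
    pos (Q 1 0 n * W 1 (3 * n)) ℤ.* (1ℤ ℤ.- pos 9 ℤ.* pos m ℤ.* (pos (suc n) ℤ.* pos (suc n))) ∎
    where
    open ≈-Reasoning (≋-setoid (modulus 3 m))
    v = 1ℤ ℤ.- pos 9 ℤ.* pos m ℤ.* (pos n ℤ.* pos n)
    w = 1ℤ ℤ.- pos 9 ℤ.* pos m ℤ.* (pos 2 ℤ.* pos n ℤ.+ 1ℤ)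
    interchange : ∀ a b c d → a ℤ.* b ℤ.* (c ℤ.* d) ≡ a ℤ.* c ℤ.* (b ℤ.* d)
    interchange = ℤSolver.solve-∀

  n*multichoose : ∀ n → ∃ λ y → n * multichoose m n ≡ m * y
  n*multichoose zero    = 0 , sym (*-zeroʳ m)
  n*multichoose (suc n) = multichoose (suc m) n , trans (multichoose-absorbʳ m n) (sym (multichoose-absorbˡ m n))

  multichoose*Q₁-≋ : ∀ n → pos (multichoose m n) ℤ.* pos (Q 1 (3 * m) n) ≋ pos (multichoose m n) ℤ.* pos (Q 1 0 n) [ modulus 3 m ]
  multichoose*Q₁-≋ n with y , n*c≡m*y ← n*multichoose n =
    ≋-trans (≋-*-cong (≋-refl {a = pos (multichoose m n)}) (Q₁-≋ n))
      (vanish {m′ = pos m′} {n = pos n} (pos (Q 1 0 n)) m≡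
        (trans (sym (ℤ.pos-* n (multichoose m n))) (trans (cong pos n*c≡m*y) (ℤ.pos-* m y))))
    where
    -- The error is -9 m q n (n c), and n c = m y is a multiple of 3.
    vanish : ∀ {m m′ n c y} q → m ≡ m′ ℤ.* pos 3 → n ℤ.* c ≡ m ℤ.* y →
             c ℤ.* (q ℤ.* (1ℤ ℤ.- pos 9 ℤ.* m ℤ.* (n ℤ.* n))) ≋ c ℤ.* q [ pos 3 ℤ.* pos 3 ℤ.* pos 3 ℤ.* m ]
    vanish {m} {m′} {n} {c} {y} q m≡ nc≡ = mod (divides (ℤ.- (q ℤ.* n ℤ.* m′ ℤ.* y)) (begin
      c ℤ.* (q ℤ.* (1ℤ ℤ.- pos 9 ℤ.* m ℤ.* (n ℤ.* n))) ℤ.- c ℤ.* q    ≡⟨ expand c q m n ⟩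
      ℤ.- (pos 9 ℤ.* m ℤ.* q ℤ.* n ℤ.* (n ℤ.* c))                    ≡⟨ cong (λ x → ℤ.- (pos 9 ℤ.* m ℤ.* q ℤ.* n ℤ.* x)) nc≡ ⟩
      ℤ.- (pos 9 ℤ.* m ℤ.* q ℤ.* n ℤ.* (m ℤ.* y))                    ≡⟨ cong (λ x → ℤ.- (pos 9 ℤ.* m ℤ.* q ℤ.* n ℤ.* (x ℤ.* y))) m≡ ⟩
      ℤ.- (pos 9 ℤ.* m ℤ.* q ℤ.* n ℤ.* (m′ ℤ.* pos 3 ℤ.* y))         ≡⟨ collect m m′ n q y ⟩
      ℤ.- (q ℤ.* n ℤ.* m′ ℤ.* y) ℤ.* (pos 3 ℤ.* pos 3 ℤ.* pos 3 ℤ.* m) ∎))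
      where
      open ≡-Reasoning
      expand : ∀ c q m n → c ℤ.* (q ℤ.* (1ℤ ℤ.- pos 9 ℤ.* m ℤ.* (n ℤ.* n))) ℤ.- c ℤ.* q ≡ ℤ.- (pos 9 ℤ.* m ℤ.* q ℤ.* n ℤ.* (n ℤ.* c))
      expand = ℤSolver.solve-∀
      collect : ∀ m m′ n q y → ℤ.- (pos 9 ℤ.* m ℤ.* q ℤ.* n ℤ.* (m′ ℤ.* pos 3 ℤ.* y))
        ≡ ℤ.- (q ℤ.* n ℤ.* m′ ℤ.* y) ℤ.* (pos 3 ℤ.* pos 3 ℤ.* pos 3 ℤ.* m)
      collect = ℤSolver.solve-∀

even∨odd : ∀ n → ∃ λ h → n ≡ h + h ⊎ n ≡ suc (h + h)
even∨odd zero = 0 , inj₁ refl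
even∨odd (suc n) with even∨odd n
... | h , inj₁ refl = h , inj₂ refl
... | h , inj₂ refl = suc h , inj₁ (cong suc (sym (+-suc h h)))

prime⇒odd : ∀ {p} → Prime p → 3 ≤ p → ∃ λ h → p ≡ suc (h + h)
prime⇒odd {p} pr 3≤p with even∨odd p
... | h , inj₂ p≡ = h , p≡
... | h , inj₁ p≡ with prime⇒irreducible pr (divides h (trans p≡ (trans (cong (_+_ h) (sym (+-identityʳ h))) (*-comm 2 h))))
...   | inj₂ refl = contradiction 3≤p λ { (s≤s (s≤s ())) }

-- Both sides are convolutions with the same series `prodTo p m n`, so a congruence between the
-- other factors, coefficient by coefficient, suffices.
d-≋ : ∀ p m M n → 2 ≤ p → 1 ≤ n → (∀ j → pos (multichoose (p * m) (p * j)) ≋ pos (multichoose m j) [ M ]) →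
      pos (d p m (p * n)) ≋ pos (d p m n) [ M ]
d-≋ p m M n 2≤p 1≤n c≋ = begin
  pos (d p m (p * n))
    ≡⟨ cong pos (d-multiple p m n 2≤p 1≤n) ⟩
  pos ((prodTo p m n ⊛ (multichoose (p * m) ∘ (_*_ p))) n)
    ≈⟨ ⊛-congʳ-≋ (prodTo p m n) (multichoose (p * m) ∘ (_*_ p)) (multichoose m) n c≋ ⟩
  pos ((prodTo p m n ⊛ multichoose m) n)
    ≡⟨ cong pos (⊛-comm (prodTo p m n) (multichoose m) n) ⟩
  pos (d p m n) ∎
  where open ≈-Reasoning (≋-setoid M)

theorem5p5 : (p m k : ℕ) → Prime p → 3 ≤ p → 1 ≤ m → IsValuation p m k →
    (5 ≤ p ⊎ (p ≡ 3 × 1 ≤ k)) →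
    (n : ℕ) → 1 ≤ n → d p m (p * n) ≡ d p m n [mod p ^ (k + 3) ]
theorem5p5 p m k pr 3≤p _ (pᵏ∣m , _) (inj₁ 5≤p) n 1≤n with h , refl ← prime⇒odd pr 3≤p =
  ℤ∣.∣⇒∣ᵤ (difference (d-≋ p m (pos (p ^ (k + 3))) n (≤-trans (n≤1+n 2) 3≤p) 1≤n
    (λ j → multichoose-≋ h pr m k j pᵏ∣m (≋-*-cong (≋-refl {a = pos (multichoose m j)}) (Q-≋ h pr 5≤p m j)))))
theorem5p5 p m k@(suc k′) pr 3≤p _ (pᵏ∣m , _) (inj₂ (refl , _)) n 1≤n =
  ℤ∣.∣⇒∣ᵤ (difference (d-≋ 3 m (pos (3 ^ (k + 3))) n (n≤1+n 2) 1≤n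
    -- Here h = 1, and 3 ∣ m follows from 3^k ∣ m because k is a successor.
    (λ j → multichoose-≋ 1 pr m k j pᵏ∣m (multichoose*Q₁-≋ m (m*n∣⇒m∣ 3 (3 ^ k′) pᵏ∣m) j))))
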